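{- (1) Let $T=S_{2,1,\dots,1}$ be a spider with one leg of 2 edges and at least two legs of 1 edge. Then $\mathrm{ex}_c(n,T)=\lfloor \frac{n(\Delta(T)-1)}{2}\rfloor$ for all $n\ge |T|$. In particular $\mathrm{ex}_c(n,S_{2,1,1})=n$ for $n\ge 5$ and $\mathrm{ex}_c(n,S_{2,1,1,1})=\lfloor \frac{3n}{2}\rfloor$ for $n\ge 6$. (2) $\mathrm{ex}_c(n,D_{2,2})=2n-4$ for all $n\ge 6$. (3) $\mathrm{ex}_c(n,S_{3,1,1})=\lfloor \frac{3(n-1)}{2}\rfloor$ for all $n\ge 7$, and $\mathrm{ex}_c(6,S_{3,1,1})=9$. (4) $\mathrm{ex}_c(n,S_{2,2,1})=2n-3$ for all $n\ge 6$.
   Context: $\mathrm{ex}_c(n,F)$ denotes the largest number of edges in a connected $n$-vertex graph containing no subgraph isomorphic to $F$. For $j\ge 3$, the spider $S_{a_1,\dots,a_j}$ is the tree obtained from $j$ paths with $a_1,\dots,a_j$ edges by identifying one endpoint of each path; it has $1+\sum a_i$ vertices and maximum degree $j$; the identified vertex is the center and the paths are the legs. $D_{a,b}$ is the double star on $a+b+2$ vertices whose two non-leaf vertices (which are adjacent) have degrees $a+1$ and $b+1$. $|T|$ is the number of vertices of $T$ and $\Delta(T)$ its maximum degree. -}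

module Defs where

open import Data.Nat using (ℕ; zero; suc; _+_; _*_; _∸_; _≤_; _<ᵇ_; _≡ᵇ_)
open import Data.Bool using (Bool; true; false; _∧_; _∨_; if_then_else_)
open import Data.Fin using (Fin; toℕ)
open import Data.List using (List; []; _∷_; _++_; map; upTo; replicate; allFin)
open import Data.Nat.ListAction using (sum)
open import Data.Bool.ListAction using (any)
open import Data.Product using (Σ; _×_; _,_; ∃)
open import Relation.Binary.PropositionalEquality using (_≡_)
open import Relation.Nullary using (¬_)
open import Function.Definitions using (Injective)

record Graph (n : ℕ) : Set where
  field
    adj   : Fin n → Fin n → Bool
    sym   : ∀ i j → adj i j ≡ adj j i
    irrfl : ∀ i → adj i i ≡ false
open Graph public

edgeCount : ∀ {n} → Graph n → ℕ
edgeCount {n} G =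
  sum (map (λ i → sum (map (λ j → if (toℕ i <ᵇ toℕ j) ∧ adj G i j then 1 else 0)
                           (allFin n)))
           (allFin n))

data Reach {n} (G : Graph n) : Fin n → Fin n → Set where
  here : ∀ {u} → Reach G u u
  step : ∀ {u v w} → adj G u v ≡ true → Reach G v w → Reach G u w

Connected : ∀ {n} → Graph n → Set
Connected {n} G = ∀ (u v : Fin n) → Reach G u v

record Pattern : Set where
  field
    size : ℕ
    padj : Fin size → Fin size → Bool
open Pattern public

Contains : ∀ {n} → Graph n → Pattern → Set
Contains {n} G F =
  Σ (Fin (size F) → Fin n) λ φ →
    Injective _≡_ _≡_ φ ×
    (∀ i j → padj F i j ≡ true → adj G (φ i) (φ j) ≡ true)

IsExc : ℕ → Pattern → ℕ → Set
IsExc n F m =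
  (Σ (Graph n) λ G → Connected G × ¬ Contains G F × edgeCount G ≡ m) ×
  (∀ (G : Graph n) → Connected G → ¬ Contains G F → edgeCount G ≤ m)

fromEdges : (k : ℕ) → List (ℕ × ℕ) → Pattern
fromEdges k es = record
  { size = k
  ; padj = λ i j → any (λ { (a , b) →
        ((toℕ i ≡ᵇ a) ∧ (toℕ j ≡ᵇ b)) ∨ ((toℕ i ≡ᵇ b) ∧ (toℕ j ≡ᵇ a)) }) es }

legEdges : ℕ → ℕ → ℕ → List (ℕ × ℕ)
legEdges prev v zero = []
legEdges prev v (suc a) = (prev , v) ∷ legEdges v (suc v) a

-- legs starting at next free vertex v; center is vertex 0
spiderEdges : ℕ → List ℕ → List (ℕ × ℕ)
spiderEdges v [] = []
spiderEdges v (a ∷ as) = legEdges 0 v a ++ spiderEdges (v + a) as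

Spider : List ℕ → Pattern
Spider legs = fromEdges (suc (sum legs)) (spiderEdges 1 legs)

DoubleStar : ℕ → ℕ → Pattern
DoubleStar a b = fromEdges (2 + a + b)
  ((0 , 1) ∷ (map (λ i → (0 , 2 + i)) (upTo a) ++ map (λ i → (1 , 2 + a + i)) (upTo b)))

{-# OPTIONS --safe #-}
-- In every part the extremal graphs are given explicitly, and the upper bound is a bound on the
-- sum of the degrees, which is twice the number of edges.
--
-- (1) A vertex of degree at least k + 1 in an S_{2,1,…,1}-free connected graph is adjacent to
-- everything and the graph is a star; otherwise all degrees are at most k.  A circulant graph
-- attains the bound.
--
-- (2), (4) Give each vertex u the charge 4 − deg u; the total must be at least 7 (then 8, by
-- parity), respectively 6.  Freeness forces almost all neighbours of a vertex of degree at least 4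
-- to have small degree, so let each vertex of small degree send charge 1 to each neighbour of
-- degree at least 4.  Then no charge is negative and the vertices of degree at least 4 end with
-- a surplus; in (4) a vertex adjacent to everything needs a separate argument.  Attained by
-- K_{2,n−2} and K_{1,1,n−2}.
--
-- (3) Charges are 3 − deg u.  If v has degree at least 3, freeness forces every vertex to be
-- within distance 2 of v with the vertices at distance 2 adjacent to N(v) only, and charge is
-- moved between v, N(v) and the rest.  Attained by a cone over a matching and by K_{3,3}.
module Submission where

open import Defs renaming (sym to adj-sym; irrfl to adj-irrefl)
open import Data.Bool using (Bool; true; false; _∧_; _∨_; _xor_; not; if_then_else_)
open import Data.Bool.Properties as Bool using (T-≡; ∧-comm; ∧-zeroʳ; xor-comm; xor-same)
open import Data.Empty using (⊥; ⊥-elim)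
open import Data.Fin as Fin using (Fin; zero; suc; toℕ; fromℕ<)
open import Data.Fin.Induction using (<-weakInduction)
open import Data.Fin.Patterns using (0F; 1F; 2F; 3F; 4F; 5F)
open import Data.Fin.Properties as Fin using (_≟_; any?; toℕ-injective; toℕ<n; toℕ-inject₁; toℕ-fromℕ<)
open import Data.List using (List; []; _∷_; map; length; tabulate; allFin; replicate)
open import Data.List.Properties using (map-tabulate; length-tabulate)
open import Data.List.Membership.Propositional using (_∈_; _∉_)
open import Data.List.Membership.Propositional.Properties using (∈-map⁻)
open import Data.List.Relation.Unary.All as All using (All; []; _∷_)
open import Data.List.Relation.Unary.AllPairs using ([]; _∷_)
open import Data.List.Relation.Unary.Any using (here; there)
open import Data.List.Relation.Unary.Unique.Propositional using (Unique)
import Data.List.Relation.Unary.All.Properties as All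
import Data.List.Relation.Unary.Unique.Propositional.Properties as Unique
import Data.List.Membership.DecPropositional as DecMembership
open import Data.Nat as ℕ using (ℕ; zero; suc; _+_; _*_; _∸_; _≤_; _<_; _/_; z≤n; s≤s; s≤s⁻¹; _≤ᵇ_; _<ᵇ_; _≡ᵇ_; _≤?_; _<?_; _%_; ∣_-_∣; _⊓_)
open import Data.Nat.ListAction using (sum)
open import Data.Nat.DivMod using (m*n/n≡m; /-monoˡ-≤; m/n*n≤m; m≡m%n+[m/n]*n; m%n<n)
open import Data.Nat.Properties hiding (_≟_)
open import Data.Nat.Tactic.RingSolver using (solve-∀)
open import Data.Product using (∃; ∃₂; _×_; _,_; proj₁; proj₂)
open import Data.Sum using (_⊎_; inj₁; inj₂; [_,_]′)
open import Function using (_∘_; id; case_of_)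
open import Function.Bundles using (Equivalence)
open import Relation.Binary.PropositionalEquality using (_≡_; _≢_; refl; sym; trans; cong; cong₂; subst; ≢-sym; module ≡-Reasoning)
open import Relation.Nullary using (¬_; Dec; yes; no; does; contradiction)
open import Relation.Nullary.Decidable using (_×-dec_; ¬?; decidable-stable)
open import Algebra.Properties.CommutativeMonoid.Sum +-0-commutativeMonoid
  using (∑-distrib-+; ∑-comm; sum-cong-≗) renaming (sum to ∑)

-- Connectivity enters through one alternative: a vertex `v` is adjacent to all others, or a path
-- `v`, `a`, `x` leaves its closed neighbourhood (`Exit`). As `x` is not adjacent to `v`, leaves
-- picked from N(`v`) can never collide with it, so every exit saves one in the degree that an
-- embedding requires. Everything is stated over ℕ without subtraction: a deficit of charge is an
-- `excess`, a surplus a `slack`, and they stand on opposite sides of one inequality. The smallest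
-- order shapes two of the proofs. For D_{2,2} on six vertices, degree sum 18 has to be excluded,
-- that is, the cubic graphs. For S_{3,1,1}, the graph K_{3,3} beats the general formula at n = 6;
-- the bounds 3n - 3, 2n + 4 and 18 on the degree sum are therefore kept apart, and the last two
-- drop to 3n - 3 or less only from n = 7 on.

private
  variable
    n : ℕ

-- Finite sums, degrees and discharging

⟦_⟧ : Bool → ℕ
⟦ b ⟧ = if b then 1 else 0

∑-mono : {f g : Fin n → ℕ} → (∀ i → f i ≤ g i) → ∑ f ≤ ∑ g
∑-mono {zero}  f≤g = z≤n
∑-mono {suc n} f≤g = +-mono-≤ (f≤g zero) (∑-mono (f≤g ∘ suc))

∑-const : ∀ n c → ∑ {n} (λ _ → c) ≡ n * c
∑-const zero    c = refl
∑-const (suc n) c = cong (c +_) (∑-const n c)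

∑-zero : {f : Fin n → ℕ} → (∀ i → f i ≡ 0) → ∑ f ≡ 0
∑-zero {zero}  f≡0 = refl
∑-zero {suc n} f≡0 = cong₂ _+_ (f≡0 zero) (∑-zero (f≡0 ∘ suc))

sum-map-allFin : (f : Fin n → ℕ) → sum (map f (allFin n)) ≡ ∑ f
sum-map-allFin f = trans (cong sum (map-tabulate id f)) (sum-tabulate f)
  where
  sum-tabulate : ∀ {m} (g : Fin m → ℕ) → sum (tabulate g) ≡ ∑ g
  sum-tabulate {zero}  g = refl
  sum-tabulate {suc m} g = cong (g zero +_) (sum-tabulate (g ∘ suc))

_at_ : ℕ → Fin n → Fin n → ℕ
(e at v) u = if does (u ≟ v) then e else 0

at-same : ∀ e (v : Fin n) → (e at v) v ≡ e
at-same e v with v ≟ v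
... | yes _  = refl
... | no v≢v = contradiction refl v≢v

at-diff : ∀ e {u v : Fin n} → u ≢ v → (e at v) u ≡ 0
at-diff e {u} {v} u≢v with u ≟ v
... | yes u≡v = contradiction u≡v u≢v
... | no _    = refl

∑-at : ∀ e (v : Fin n) → ∑ (e at v) ≡ e
∑-at {suc n} e zero    = trans (cong (e +_) (∑-zero {n} λ _ → refl)) (+-identityʳ e)
∑-at {suc n} e (suc v) = trans (sum-cong-≗ shift) (∑-at e v)
  where
  shift : ∀ u → (e at suc v) (suc u) ≡ (e at v) u
  shift u with u ≟ v
  ... | yes _ = refl
  ... | no _  = refl

weights : List (Fin n × ℕ) → Fin n → ℕ
weights []            u = 0
weights ((v , e) ∷ L) u = (e at v) u + weights L u

∑-weights : (L : List (Fin n × ℕ)) → ∑ (weights L) ≡ sum (map proj₂ L)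
∑-weights {n} []    = ∑-zero {n} λ _ → refl
∑-weights ((v , e) ∷ L) =
  trans (∑-distrib-+ (e at v) (weights L)) (cong₂ _+_ (∑-at e v) (∑-weights L))

weights-∉ : (L : List (Fin n × ℕ)) {u : Fin n} → All (u ≢_) (map proj₁ L) → weights L u ≡ 0
weights-∉ []            []        = refl
weights-∉ ((v , e) ∷ L) (u≢v ∷ p) = cong₂ _+_ (at-diff e u≢v) (weights-∉ L p)

#_ : (Fin n → Bool) → ℕ
# P = ∑ (⟦_⟧ ∘ P)

mem? : (u : Fin n) (L : List (Fin n)) → Dec (u ∈ L)
mem? = DecMembership._∈?_ _≟_

occurrences : List (Fin n) → Fin n → ℕ
occurrences L = weights (map (_, 1) L)

∑-occurrences : (L : List (Fin n)) → ∑ (occurrences L) ≡ length L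
∑-occurrences L = trans (∑-weights (map (_, 1) L)) (ones L)
  where
  ones : (L : List (Fin n)) → sum (map proj₂ (map (_, 1) L)) ≡ length L
  ones []      = refl
  ones (_ ∷ L) = cong suc (ones L)

∈⇒1≤occurrences : (L : List (Fin n)) {u : Fin n} → u ∈ L → 1 ≤ occurrences L u
∈⇒1≤occurrences (v ∷ L) (here refl) = ≤-trans (≤-reflexive (sym (at-same 1 v))) (m≤m+n _ _)
∈⇒1≤occurrences (v ∷ L) (there u∈L) = ≤-trans (∈⇒1≤occurrences L u∈L) (m≤n+m _ _)

⟦⟧≤1 : ∀ b → ⟦ b ⟧ ≤ 1
⟦⟧≤1 true  = ≤-refl
⟦⟧≤1 false = z≤n

⟦∨⟧≤ : ∀ a b → ⟦ a ∨ b ⟧ ≤ ⟦ a ⟧ + ⟦ b ⟧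
⟦∨⟧≤ true  b = s≤s z≤n
⟦∨⟧≤ false b = ≤-refl

#-cover : (P Q : Fin n → Bool) (L : List (Fin n)) →
          (∀ u → P u ≡ true → Q u ≡ true ⊎ u ∈ L) → # P ≤ # Q + length L
#-cover P Q L cov = begin
  # P                                   ≤⟨ ∑-mono pointwise ⟩
  ∑ (λ u → ⟦ Q u ⟧ + occurrences L u)   ≡⟨ ∑-distrib-+ (⟦_⟧ ∘ Q) (occurrences L) ⟩
  # Q + ∑ (occurrences L)               ≡⟨ cong (# Q +_) (∑-occurrences L) ⟩
  # Q + length L                        ∎
  where
  open ≤-Reasoning
  pointwise : ∀ u → ⟦ P u ⟧ ≤ ⟦ Q u ⟧ + occurrences L u
  pointwise u with P u in Pu
  ... | false = z≤n
  ... | true with cov u Pu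
  ...   | inj₁ Qu  = ≤-trans (≤-reflexive (sym (cong ⟦_⟧ Qu))) (m≤m+n _ _)
  ...   | inj₂ u∈L = ≤-trans (∈⇒1≤occurrences L u∈L) (m≤n+m _ _)

#-⊆list : (P : Fin n → Bool) (L : List (Fin n)) → (∀ u → P u ≡ true → u ∈ L) → # P ≤ length L
#-⊆list {n} P L cov = ≤-trans (#-cover P (λ _ → false) L (λ u → inj₂ ∘ cov u))
  (≤-reflexive (cong (_+ length L) (∑-zero {n} λ _ → refl)))

list⊆-# : (P : Fin n → Bool) (L : List (Fin n)) → Unique L → All (λ u → P u ≡ true) L →
          length L ≤ # P
list⊆-# P L uniq inP = ≤-trans (≤-reflexive (sym (∑-occurrences L))) (∑-mono (λ u → pw L uniq inP u))
  where
  absent : ∀ (L : List _) {u} → All (u ≢_) L → occurrences L u ≡ 0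
  absent []      []        = refl
  absent (v ∷ L) (u≢v ∷ p) = cong₂ _+_ (at-diff 1 u≢v) (absent L p)
  pw : ∀ L → Unique L → All (λ u → P u ≡ true) L → ∀ u → occurrences L u ≤ ⟦ P u ⟧
  pw []      _           _         u = z≤n
  pw (v ∷ L) (v∉L ∷ uL) (Pv ∷ PL) u with u ≟ v
  ... | yes refl = ≤-reflexive (trans (cong suc (absent L v∉L)) (sym (cong ⟦_⟧ Pv)))
  ... | no _     = pw L uL PL u

∈⇒≤weights : (L : List (Fin n × ℕ)) {u : Fin n} {e : ℕ} → (u , e) ∈ L → e ≤ weights L u
∈⇒≤weights ((v , e) ∷ L) (here refl) = ≤-trans (≤-reflexive (sym (at-same e v))) (m≤m+n _ _)
∈⇒≤weights ((v , e) ∷ L) (there u∈L) = ≤-trans (∈⇒≤weights L u∈L) (m≤n+m _ _)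

-- Repeated vertices in `excess` only weaken the conclusion, so they are allowed; a repeated vertex
-- in `slack` would be counted twice, hence `Unique`. At a vertex of `slack` the stronger inequality
-- is used, whether or not it also occurs in `excess`.
balance : (F H : Fin n → ℕ) (excess slack : List (Fin n × ℕ)) →
  (∀ u → u ∉ map proj₁ excess → F u ≤ H u) →
  All (λ p → F (proj₁ p) ≤ H (proj₁ p) + proj₂ p) excess →
  Unique (map proj₁ slack) →
  All (λ p → F (proj₁ p) + proj₂ p ≤ H (proj₁ p)) slack →
  ∑ F + sum (map proj₂ slack) ≤ ∑ H + sum (map proj₂ excess)
balance F H M L bound over uniq under = begin
  ∑ F + sum (map proj₂ L)       ≡⟨ cong (∑ F +_) (sym (∑-weights L)) ⟩
  ∑ F + ∑ (weights L)           ≡⟨ sym (∑-distrib-+ F (weights L)) ⟩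
  ∑ (λ u → F u + weights L u)   ≤⟨ ∑-mono (λ u → pointwise u L uniq under) ⟩
  ∑ (λ u → H u + weights M u)   ≡⟨ ∑-distrib-+ H (weights M) ⟩
  ∑ H + ∑ (weights M)           ≡⟨ cong (∑ H +_) (∑-weights M) ⟩
  ∑ H + sum (map proj₂ M)       ∎
  where
  open ≤-Reasoning
  unslack : ∀ u → F u + 0 ≤ H u + weights M u
  unslack u rewrite +-identityʳ (F u) with mem? u (map proj₁ M)
  ... | no u∉M = ≤-trans (bound u u∉M) (m≤m+n _ _)
  ... | yes u∈M with ∈-map⁻ proj₁ u∈M
  ...   | (.u , e) , p∈M , refl = ≤-trans (All.lookup over p∈M) (+-monoʳ-≤ (H u) (∈⇒≤weights M p∈M))
  pointwise : ∀ u L → Unique (map proj₁ L) →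
    All (λ p → F (proj₁ p) + proj₂ p ≤ H (proj₁ p)) L → F u + weights L u ≤ H u + weights M u
  pointwise u []            _          _        = unslack u
  pointwise u ((v , e) ∷ L) (v∉L ∷ uL) (s ∷ sL) with u ≟ v
  ... | yes refl = ≤-trans (≤-trans (≤-reflexive (cong (F u +_)
                     (trans (cong (e +_) (weights-∉ L v∉L)) (+-identityʳ e)))) s) (m≤m+n _ _)
  ... | no _     = pointwise u L uL sL

bounded : (f : Fin n → ℕ) (c : ℕ) (excess slack : List (Fin n × ℕ)) →
  (∀ u → u ∉ map proj₁ excess → f u ≤ c) →
  All (λ p → f (proj₁ p) ≤ c + proj₂ p) excess →
  Unique (map proj₁ slack) →
  All (λ p → f (proj₁ p) + proj₂ p ≤ c) slack →
  ∑ f + sum (map proj₂ slack) ≤ n * c + sum (map proj₂ excess)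
bounded {n} f c M L bound over uniq under =
  ≤-trans (balance f (λ _ → c) M L bound over uniq under)
          (≤-reflexive (cong (_+ sum (map proj₂ M)) (∑-const n c)))

-- Discharging along a relation

module _ (t : Fin n → Fin n → Bool) where

  outflow inflow : Fin n → ℕ
  outflow u = # (t u)
  inflow w = # (λ u → t u w)

  ∑-outflow≡∑-inflow : ∑ outflow ≡ ∑ inflow
  ∑-outflow≡∑-inflow = ∑-comm (λ u w → ⟦ t u w ⟧)

  -- `t u w` means that `u` sends one unit to `w`. A vertex with charge `c` - `f u` ends with `c` +
  -- inflow - `f u` - outflow, and the total is unchanged because both flows count the pairs related
  -- by `t`.
  discharge : (f : Fin n → ℕ) (c : ℕ) (excess slack : List (Fin n × ℕ)) →
    (∀ u → u ∉ map proj₁ excess → f u + outflow u ≤ c + inflow u) →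
    All (λ p → f (proj₁ p) + outflow (proj₁ p) ≤ c + inflow (proj₁ p) + proj₂ p) excess →
    Unique (map proj₁ slack) →
    All (λ p → f (proj₁ p) + outflow (proj₁ p) + proj₂ p ≤ c + inflow (proj₁ p)) slack →
    ∑ f + sum (map proj₂ slack) ≤ n * c + sum (map proj₂ excess)
  discharge f c M L bound over uniq under = +-cancelʳ-≤ (∑ outflow) _ _ (begin
    ∑ f + sum (map proj₂ L) + ∑ outflow        ≡⟨ swap (∑ f) _ _ ⟩
    ∑ f + ∑ outflow + sum (map proj₂ L)        ≡⟨ cong (_+ sum (map proj₂ L)) (sym (∑-distrib-+ f outflow)) ⟩
    ∑ (λ u → f u + outflow u) + sum (map proj₂ L)
      ≤⟨ balance (λ u → f u + outflow u) (λ u → c + inflow u) M L bound over uniq under ⟩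
    ∑ (λ u → c + inflow u) + sum (map proj₂ M)
      ≡⟨ cong (_+ sum (map proj₂ M)) (trans (∑-distrib-+ (λ _ → c) inflow)
           (cong₂ _+_ (∑-const n c) (sym ∑-outflow≡∑-inflow))) ⟩
    n * c + ∑ outflow + sum (map proj₂ M)      ≡⟨ swap (n * c) _ _ ⟩
    n * c + sum (map proj₂ M) + ∑ outflow      ∎)
    where
    open ≤-Reasoning
    swap : ∀ a b c → a + b + c ≡ a + c + b
    swap = solve-∀

-- Degrees, neighbours and exits from a neighbourhood

module _ (G : Graph n) where

  deg : Fin n → ℕ
  deg u = # (adj G u)

  infix 4 _~_
  _~_ : Fin n → Fin n → Set
  u ~ w = adj G u w ≡ true

  _~?_ : ∀ u w → Dec (u ~ w)
  u ~? w = adj G u w Bool.≟ true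

  ~-sym : ∀ {u w} → u ~ w → w ~ u
  ~-sym {u} {w} = trans (adj-sym G w u)

  ~⇒≢ : ∀ {u w} → u ~ w → u ≢ w
  ~⇒≢ {u} u~u refl = case trans (sym u~u) (adj-irrefl G u) of λ ()

  private
    up : Fin n → Fin n → ℕ
    up i j = if (toℕ i <ᵇ toℕ j) ∧ adj G i j then 1 else 0

  edgeCount≡∑ : edgeCount G ≡ ∑ (λ i → ∑ (up i))
  edgeCount≡∑ = trans (sum-map-allFin (λ i → sum (map (up i) (allFin n)))) (sum-cong-≗ (λ i → sum-map-allFin (up i)))

  handshake : edgeCount G + edgeCount G ≡ ∑ deg
  handshake = begin
    edgeCount G + edgeCount G
      ≡⟨ cong₂ _+_ edgeCount≡∑ edgeCount≡∑ ⟩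
    ∑ (λ i → ∑ (λ j → up i j)) + ∑ (λ i → ∑ (λ j → up i j))
      ≡⟨ cong (∑ (λ i → ∑ (λ j → up i j)) +_) (∑-comm up) ⟩
    ∑ (λ i → ∑ (λ j → up i j)) + ∑ (λ j → ∑ (λ i → up i j))
      ≡⟨ sym (∑-distrib-+ (λ i → ∑ (λ j → up i j)) _) ⟩
    ∑ (λ i → ∑ (λ j → up i j) + ∑ (λ j → up j i))
      ≡⟨ sum-cong-≗ (λ i → sym (∑-distrib-+ (up i) (λ j → up j i))) ⟩
    ∑ (λ i → ∑ (λ j → up i j + up j i))
      ≡⟨ sum-cong-≗ (λ i → sum-cong-≗ (oriented i)) ⟩
    ∑ deg ∎
    where
    open ≡-Reasoning
    oriented : ∀ i j → up i j + up j i ≡ ⟦ adj G i j ⟧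
    oriented i j with toℕ i <ᵇ toℕ j in i<j | toℕ j <ᵇ toℕ i in j<i
    ... | true  | true  = contradiction (<ᵇ⇒< (toℕ j) (toℕ i) (Equivalence.from T-≡ j<i))
                                        (<-asym (<ᵇ⇒< (toℕ i) (toℕ j) (Equivalence.from T-≡ i<j)))
    ... | true  | false = +-identityʳ _
    ... | false | true  = cong ⟦_⟧ (adj-sym G j i)
    ... | false | false = sym (cong ⟦_⟧ (trans (cong (adj G i) (sym i≡j)) (adj-irrefl G i)))
      where
      ≮ : ∀ {a b} → (a <ᵇ b) ≡ false → b ≤ a
      ≮ p = ≮⇒≥ (λ a<b → case trans (sym p) (Equivalence.to T-≡ (<⇒<ᵇ a<b)) of λ ())
      i≡j : i ≡ j
      i≡j = toℕ-injective (≤-antisym (≮ j<i) (≮ i<j))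

  pick : ∀ u (L : List (Fin n)) → length L < deg u → ∃ λ w → u ~ w × w ∉ L
  pick u L L<d with any? (λ w → (u ~? w) ×-dec ¬? (mem? w L))
  ... | yes p = p
  ... | no ∄  = contradiction
    (#-⊆list (adj G u) L (λ w u~w → decidable-stable (mem? w L) (λ w∉L → ∄ (w , u~w , w∉L))))
    (<⇒≱ L<d)

  deg≤ : ∀ u (L : List (Fin n)) → (∀ w → u ~ w → w ∈ L) → deg u ≤ length L
  deg≤ u = #-⊆list (adj G u)

  -- The source of the leaves of every forbidden tree below; `L` lists the vertices that the tree
  -- already uses.
  pickMany : ∀ k u (L : List (Fin n)) → k + length L ≤ deg u →
    ∃ λ W → length W ≡ k × Unique W × All (u ~_) W × All (λ w → All (w ≢_) L) W
  pickMany zero    u L _ = [] , refl , [] , [] , []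
  pickMany (suc k) u L le with pick u L (≤-trans (s≤s (m≤n+m _ k)) le)
  ... | w , u~w , w∉L with pickMany k u (w ∷ L) (≤-trans (≤-reflexive (+-suc k _)) le)
  ...   | W , |W| , uniq , u~W , avoid =
    w ∷ W , cong suc |W| , All.map (λ { (x≢w ∷ _) → ≢-sym x≢w }) avoid ∷ uniq , u~w ∷ u~W ,
    ∉⇒All w∉L ∷ All.map (λ { (_ ∷ p) → p }) avoid
    where
    ∉⇒All : ∀ {x : Fin n} {L} → x ∉ L → All (x ≢_) L
    ∉⇒All {L = []}    _   = []
    ∉⇒All {L = y ∷ L} x∉L = (x∉L ∘ here) ∷ ∉⇒All (x∉L ∘ there)

  Universal : Fin n → Set
  Universal v = ∀ u → u ≢ v → v ~ u

  record Exit (v : Fin n) : Set where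
    constructor exit
    field
      {a x} : Fin n
      v~a   : v ~ a
      a~x   : a ~ x
      x≢v   : x ≢ v
      v≁x   : ¬ v ~ x

  -- A walk from `v` to a vertex outside the closed neighbourhood has a first step that leaves it;
  -- that step is the second edge of the exit.
  universal-or-exit : Connected G → ∀ v → Universal v ⊎ Exit v
  universal-or-exit conn v with any? (λ u → ¬? (u ≟ v) ×-dec ¬? (v ~? u))
  ... | no ∄ = inj₁ (λ u u≢v → decidable-stable (v ~? u) (λ v≁u → ∄ (u , u≢v , v≁u)))
  ... | yes (y , y≢v , v≁y) = inj₂ (walk (conn v y) (inj₁ refl))
    where
    walk : ∀ {u} → Reach G u y → u ≡ v ⊎ v ~ u → Exit v
    walk here               (inj₁ y≡v) = contradiction y≡v y≢v
    walk here               (inj₂ v~y) = contradiction v~y v≁y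
    walk (step u~w r) (inj₁ refl) = walk r (inj₂ u~w)
    walk (step {v = w} u~w r) (inj₂ v~u) with w ≟ v | v ~? w
    ... | yes w≡v | _       = walk r (inj₁ w≡v)
    ... | no _    | yes v~w = walk r (inj₂ v~w)
    ... | no w≢v  | no v≁w  = exit v~u u~w w≢v v≁w

  universal⇒n≤1+deg : ∀ {v} → Universal v → n ≤ suc (deg v)
  universal⇒n≤1+deg {v} univ = begin
    n                         ≡⟨ sym (*-identityʳ n) ⟩
    n * 1                     ≡⟨ sym (∑-const n 1) ⟩
    #_ {n} (λ _ → true)       ≤⟨ #-cover (λ _ → true) (adj G v) (v ∷ []) cov ⟩
    deg v + 1                 ≡⟨ +-comm (deg v) 1 ⟩
    suc (deg v)               ∎
    where
    open ≤-Reasoning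
    cov : ∀ u → true ≡ true → v ~ u ⊎ u ∈ v ∷ []
    cov u _ with u ≟ v
    ... | yes u≡v = inj₂ (here u≡v)
    ... | no u≢v  = inj₁ (univ u u≢v)

  deg<n : ∀ v → deg v < n
  deg<n v = begin
    suc (deg v)                           ≡⟨ cong (_+ deg v) (sym (∑-at 1 v)) ⟩
    ∑ (1 at v) + deg v                    ≡⟨ sym (∑-distrib-+ (1 at v) _) ⟩
    ∑ (λ u → (1 at v) u + ⟦ adj G v u ⟧)  ≤⟨ ∑-mono pw ⟩
    ∑ {n} (λ _ → 1)                       ≡⟨ trans (∑-const n 1) (*-identityʳ n) ⟩
    n                                     ∎
    where
    open ≤-Reasoning
    pw : ∀ u → (1 at v) u + ⟦ adj G v u ⟧ ≤ 1
    pw u with u ≟ v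
    ... | yes refl = ≤-reflexive (cong (suc ∘ ⟦_⟧) (adj-irrefl G v))
    ... | no _     = ⟦⟧≤1 _

  2+deg≤n⇒exit : Connected G → ∀ {v} → 2 + deg v ≤ n → Exit v
  2+deg≤n⇒exit conn {v} le with universal-or-exit conn v
  ... | inj₂ ex   = ex
  ... | inj₁ univ = contradiction (universal⇒n≤1+deg univ) (<⇒≱ le)

  -- Apart from `v`, N(`a`) lies in N(`v`) without `a` and `b`: one additional vertex is set against
  -- two missing ones.
  nested⇒deg< : ∀ {v a b} → v ~ a → v ~ b → a ≢ b → ¬ a ~ b →
    (∀ w → a ~ w → w ≢ v → v ~ w) → deg a < deg v
  nested⇒deg< {v} {a} {b} v~a v~b a≢b a≁b inner = +-cancelʳ-≤ 1 _ _ (≤-trans (≤-reflexive (sym (+-suc (deg a) 1)))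
    (balance (⟦_⟧ ∘ adj G a) (⟦_⟧ ∘ adj G v) ((v , 1) ∷ []) ((a , 1) ∷ (b , 1) ∷ [])
      in-N (≤-trans (⟦⟧≤1 (adj G a v)) (m≤n+m 1 _) ∷ []) ((a≢b ∷ []) ∷ [] ∷ [])
      (one v~a (λ a~a → ~⇒≢ a~a refl) ∷ one v~b a≁b ∷ [])))
    where
    in-N : ∀ u → u ∉ v ∷ [] → ⟦ adj G a u ⟧ ≤ ⟦ adj G v u ⟧
    in-N u u∉ with adj G a u in a~u
    ... | false = z≤n
    ... | true  = ≤-reflexive (sym (cong ⟦_⟧ (inner u a~u (u∉ ∘ here))))
    one : ∀ {u} → v ~ u → ¬ a ~ u → ⟦ adj G a u ⟧ + 1 ≤ ⟦ adj G v u ⟧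
    one {u} v~u a≁u with adj G a u
    ... | true  = contradiction refl a≁u
    ... | false = ≤-reflexive (sym (cong ⟦_⟧ v~u))

-- Embedding spiders and double stars

-- Patterns number their vertices by ℕ, so an embedding is given as the list of images in that
-- order. The default is never reached at the index of a pattern vertex.
nth : Fin n → List (Fin n) → ℕ → Fin n
nth d []      i       = d
nth d (x ∷ L) zero    = x
nth d (x ∷ L) (suc i) = nth d L i

nth-All : ∀ {P : Fin n → Set} {d} L {i} → All P L → i < length L → P (nth d L i)
nth-All (x ∷ L) {zero}  (p ∷ _)  _        = p
nth-All (x ∷ L) {suc i} (_ ∷ ps) (s≤s lt) = nth-All L ps lt

nth-injective : ∀ {d : Fin n} {L} → Unique L → ∀ {i j} → i < length L → j < length L →
                nth d L i ≡ nth d L j → i ≡ j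
nth-injective (_ ∷ _)     {zero}  {zero}  _       _       _  = refl
nth-injective (x∉L ∷ _)   {zero}  {suc j} _       (s≤s l) eq = contradiction eq (nth-All _ x∉L l)
nth-injective (x∉L ∷ _)   {suc i} {zero}  (s≤s l) _       eq = contradiction (sym eq) (nth-All _ x∉L l)
nth-injective (_ ∷ uniq)  {suc i} {suc j} (s≤s l) (s≤s m) eq = cong suc (nth-injective uniq l m eq)

≤ᵇ-sound : ∀ {a b} → (a ≤ᵇ b) ≡ true → a ≤ b
≤ᵇ-sound {a} {b} = ≤ᵇ⇒≤ a b ∘ Equivalence.from T-≡

≤ᵇ-complete : ∀ {a b} → a ≤ b → (a ≤ᵇ b) ≡ true
≤ᵇ-complete = Equivalence.to T-≡ ∘ ≤⇒≤ᵇ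

≡ᵇ-sound : ∀ {a b} → (a ≡ᵇ b) ≡ true → a ≡ b
≡ᵇ-sound {a} {b} = ≡ᵇ⇒≡ a b ∘ Equivalence.from T-≡

≡ᵇ-refl : ∀ a → (a ≡ᵇ a) ≡ true
≡ᵇ-refl a = Equivalence.to T-≡ (≡⇒≡ᵇ a a refl)

∨-true : ∀ {a b} → a ∨ b ≡ true → a ≡ true ⊎ b ≡ true
∨-true {true}  _ = inj₁ refl
∨-true {false} p = inj₂ p

∧-true : ∀ {a b} → a ∧ b ≡ true → a ≡ true × b ≡ true
∧-true {true} p = refl , p

∨-introˡ : ∀ {a b} → a ≡ true → a ∨ b ≡ true
∨-introˡ refl = refl

∨-introʳ : ∀ {a b} → b ≡ true → a ∨ b ≡ true
∨-introʳ {true}  _ = refl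
∨-introʳ {false} p = p

∧-intro : ∀ {a b} → a ≡ true → b ≡ true → a ∧ b ≡ true
∧-intro refl q = q

sum-ones : ∀ k → sum (replicate k 1) ≡ k
sum-ones zero    = refl
sum-ones (suc k) = cong suc (sum-ones k)

module _ {k : ℕ} where

  padj⇒edge : ∀ es (i j : Fin k) → padj (fromEdges k es) i j ≡ true →
    ∃₂ λ a b → (a , b) ∈ es × ((toℕ i ≡ a × toℕ j ≡ b) ⊎ (toℕ i ≡ b × toℕ j ≡ a))
  padj⇒edge ((a , b) ∷ es) i j p with ∨-true p
  ... | inj₂ q with padj⇒edge es i j q
  ...   | a′ , b′ , e∈ , eq = a′ , b′ , there e∈ , eq
  padj⇒edge ((a , b) ∷ es) i j p | inj₁ q with ∨-true q
  ... | inj₁ r with i≡ , j≡ ← ∧-true {toℕ i ≡ᵇ a} r = a , b , here refl , inj₁ (≡ᵇ-sound i≡ , ≡ᵇ-sound j≡)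
  ... | inj₂ r with i≡ , j≡ ← ∧-true {toℕ i ≡ᵇ b} r = a , b , here refl , inj₂ (≡ᵇ-sound i≡ , ≡ᵇ-sound j≡)

  edge⇒padj : ∀ {es} (i j : Fin k) → (toℕ i , toℕ j) ∈ es → padj (fromEdges k es) i j ≡ true
  edge⇒padj i j (here refl) = ∨-introˡ (∨-introˡ (∧-intro (≡ᵇ-refl (toℕ i)) (≡ᵇ-refl (toℕ j))))
  edge⇒padj i j (there {x = e} e∈) = ∨-introʳ {((toℕ i ≡ᵇ proj₁ e) ∧ (toℕ j ≡ᵇ proj₂ e)) ∨ ((toℕ i ≡ᵇ proj₂ e) ∧ (toℕ j ≡ᵇ proj₁ e))} (edge⇒padj i j e∈)

module _ (G : Graph n) where

  private
    infix 4 _∼_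
    _∼_ = _~_ G

  embed : ∀ {k} es d (L : List (Fin n)) → k ≤ length L → Unique L →
          All (λ e → nth d L (proj₁ e) ∼ nth d L (proj₂ e)) es →
          Contains G (fromEdges k es)
  embed es d L k≤ uniq edges =
    nth d L ∘ toℕ ,
    (λ {i} {j} eq → toℕ-injective (nth-injective uniq
       (<-≤-trans (toℕ<n i) k≤) (<-≤-trans (toℕ<n j) k≤) eq)) ,
    preserves
    where
    preserves : ∀ i j → padj (fromEdges _ es) i j ≡ true → nth d L (toℕ i) ∼ nth d L (toℕ j)
    preserves i j p with padj⇒edge es i j p
    ... | a , b , e∈ , inj₁ (refl , refl) = All.lookup edges e∈
    ... | a , b , e∈ , inj₂ (refl , refl) = ~-sym G (All.lookup edges e∈)

  S₂₂₁-embed : ∀ {c a a′ b b′ d} → Unique (c ∷ a ∷ a′ ∷ b ∷ b′ ∷ d ∷ []) →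
    c ∼ a → a ∼ a′ → c ∼ b → b ∼ b′ → c ∼ d → Contains G (Spider (2 ∷ 2 ∷ 1 ∷ []))
  S₂₂₁-embed {c} uniq e₁ e₂ e₃ e₄ e₅ = embed _ c _ ≤-refl uniq (e₁ ∷ e₂ ∷ e₃ ∷ e₄ ∷ e₅ ∷ [])

  S₃₁₁-embed : ∀ {c a b d e f} → Unique (c ∷ a ∷ b ∷ d ∷ e ∷ f ∷ []) →
    c ∼ a → a ∼ b → b ∼ d → c ∼ e → c ∼ f → Contains G (Spider (3 ∷ 1 ∷ 1 ∷ []))
  S₃₁₁-embed {c} uniq e₁ e₂ e₃ e₄ e₅ = embed _ c _ ≤-refl uniq (e₁ ∷ e₂ ∷ e₃ ∷ e₄ ∷ e₅ ∷ [])

  D₂₂-embed : ∀ {u v a b c d} → Unique (u ∷ v ∷ a ∷ b ∷ c ∷ d ∷ []) →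
    u ∼ v → u ∼ a → u ∼ b → v ∼ c → v ∼ d → Contains G (DoubleStar 2 2)
  D₂₂-embed {u} uniq e₁ e₂ e₃ e₄ e₅ = embed _ u _ ≤-refl uniq (e₁ ∷ e₂ ∷ e₃ ∷ e₄ ∷ e₅ ∷ [])

  private
    -- The one-edge legs are numbered from `v` on, while their ends form a list `W` of their own.
    -- The last hypothesis says that `W` is `L` from position `v` on, a form that survives the
    -- passage from `v` to `v + 1`.
    star-edges : ∀ c d L W → All (c ∼_) W → ∀ v m → 0 < v → m ≤ length W →
      nth d L 0 ≡ c → (∀ i → nth d L (v + i) ≡ nth d W i) →
      All (λ e → nth d L (proj₁ e) ∼ nth d L (proj₂ e)) (spiderEdges v (replicate m 1))
    star-edges c d L W       adjW       v zero    _   _         _    _    = []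
    star-edges c d L (w ∷ W) (c∼w ∷ cW) v (suc m) 0<v (s≤s m≤W) head tail =
      subst (_∼ nth d L v) (sym head) (subst (c ∼_) (sym (trans (cong (nth d L) (sym (+-identityʳ v))) (tail 0))) c∼w)
      ∷ star-edges c d L W cW (v + 1) m (<-≤-trans 0<v (m≤m+n v 1)) m≤W head
          (λ i → trans (cong (nth d L) (+-assoc v 1 i)) (tail (suc i)))

  S₂₁…₁-embed : ∀ k {c a b} W → length W ≡ k → Unique (c ∷ a ∷ b ∷ W) →
    c ∼ a → a ∼ b → All (c ∼_) W → Contains G (Spider (2 ∷ replicate k 1))
  S₂₁…₁-embed k {c} {a} {b} W |W|≡k uniq c∼a a∼b cW =
    embed _ c (c ∷ a ∷ b ∷ W) (s≤s (s≤s (s≤s (≤-reflexive (trans (sum-ones k) (sym |W|≡k)))))) uniq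
      (c∼a ∷ a∼b ∷ star-edges c c (c ∷ a ∷ b ∷ W) W cW 3 k (s≤s z≤n) (≤-reflexive (sym |W|≡k)) refl (λ _ → refl))

-- Upper bound for S_{2,1,…,1}

e+e≤m⇒e≤m/2 : ∀ e {m} → e + e ≤ m → e ≤ m / 2
e+e≤m⇒e≤m/2 e {m} le = begin
  e            ≡⟨ sym (m*n/n≡m e 2) ⟩
  (e * 2) / 2  ≤⟨ /-monoˡ-≤ 2 (≤-trans (≤-reflexive (double e)) le) ⟩
  m / 2        ∎
  where
  open ≤-Reasoning
  double : ∀ e → e * 2 ≡ e + e
  double = solve-∀

module _ (G : Graph n) (conn : Connected G) where

  private
    infix 4 _∼_
    _∼_ = _~_ G

  -- Here `k` is Δ(T) - 1 and `k + 3` is |T|. The star has degree sum at most 2n, which stays within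
  -- the bound because `2 ≤ k`.
  S₂₁…₁-free⇒∑deg≤ : ∀ {k} → 2 ≤ k → k + 3 ≤ n → ¬ Contains G (Spider (2 ∷ replicate k 1)) →
                      ∑ (deg G) ≤ n * k
  S₂₁…₁-free⇒∑deg≤ {k} 2≤k k+3≤n free with any? (λ v → k <? deg G v)
  ... | no ∄ = ≤-trans (m≤m+n _ 0) (≤-trans
    (bounded (deg G) k [] [] (λ u _ → ≮⇒≥ (λ k<d → ∄ (u , k<d))) [] [] []) (≤-reflexive (+-identityʳ _)))
  ... | yes (v , k<d) with universal-or-exit G conn v
  ...   | inj₂ (exit {a} {x} v∼a a∼x x≢v v≁x)
          with W , |W| , uniq , v∼W , avoid ← pickMany G k v (a ∷ []) (≤-trans (≤-reflexive (+-comm k 1)) k<d)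
    = contradiction
        (S₂₁…₁-embed G k W |W|
          ((~⇒≢ G v∼a ∷ ≢-sym x≢v ∷ All.map (~⇒≢ G) v∼W)
           ∷ (~⇒≢ G a∼x ∷ All.map (λ { (w≢a ∷ []) → ≢-sym w≢a }) avoid)
           ∷ All.map (λ v∼w x≡w → v≁x (subst (v ∼_) (sym x≡w) v∼w)) v∼W
           ∷ uniq) v∼a a∼x v∼W)
        free
  ...   | inj₁ univ = begin
    ∑ (deg G)            ≤⟨ m≤m+n _ 0 ⟩
    ∑ (deg G) + 0        ≤⟨ bounded (deg G) 1 ((v , deg G v) ∷ []) []
                              (λ u u∉ → leaf u (u∉ ∘ here)) (m≤n+m _ 1 ∷ []) [] [] ⟩
    n * 1 + (deg G v + 0) ≤⟨ +-mono-≤ (≤-reflexive (*-identityʳ n))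
                              (≤-trans (≤-reflexive (+-identityʳ _)) (<⇒≤ (deg<n G v))) ⟩
    n + n                ≡⟨ double n ⟩
    n * 2                ≤⟨ *-monoʳ-≤ n 2≤k ⟩
    n * k                ∎
    where
    open ≤-Reasoning
    double : ∀ n → n + n ≡ n * 2
    double = solve-∀
    -- When `v` is adjacent to everything, both vertices of the long leg are neighbours of `v`;
    -- beyond them `k` more are needed.
    k+2≤d : k + 2 ≤ deg G v
    k+2≤d = s≤s⁻¹ (≤-trans (≤-reflexive (sym (+-suc k 2))) (≤-trans k+3≤n (universal⇒n≤1+deg G univ)))
    leaf : ∀ u → u ≢ v → deg G u ≤ 1
    leaf u u≢v = deg≤ G u (v ∷ []) only-v
      where
      only-v : ∀ w → u ∼ w → w ∈ v ∷ []
      only-v w u∼w with w ≟ v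
      ... | yes w≡v = here w≡v
      ... | no w≢v with W , |W| , uniq , v∼W , avoid ← pickMany G k v (u ∷ w ∷ []) k+2≤d
        = contradiction
            (S₂₁…₁-embed G k W |W|
              ((≢-sym u≢v ∷ ≢-sym w≢v ∷ All.map (~⇒≢ G) v∼W)
               ∷ (~⇒≢ G u∼w ∷ All.map (λ { (y≢u ∷ _) → ≢-sym y≢u }) avoid)
               ∷ All.map (λ { (_ ∷ y≢w ∷ []) → ≢-sym y≢w }) avoid
               ∷ uniq) (univ u u≢v) u∼w v∼W)
            free

-- Upper bound for S_{2,2,1}

-- For a vertex that sends nothing and receives a unit from all but `k` of its neighbours.
sink-slack : ∀ {d o i} c k s → d ≤ i + k → o ≤ 0 → k + s ≤ c → d + o + s ≤ c + i
sink-slack {d} {o} {i} c k s d≤ o≤0 k+s≤c = begin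
  d + o + s      ≤⟨ +-monoˡ-≤ s (+-mono-≤ d≤ o≤0) ⟩
  i + k + 0 + s  ≡⟨ regroup i k s ⟩
  k + s + i      ≤⟨ +-monoˡ-≤ i k+s≤c ⟩
  c + i          ∎
  where
  open ≤-Reasoning
  regroup : ∀ i k s → i + k + 0 + s ≡ k + s + i
  regroup = solve-∀

-- For a vertex of small degree; what it receives is ignored.
source-slack : ∀ {d o} i {c} a b s → d ≤ a → o ≤ b → a + b + s ≤ c → d + o + s ≤ c + i
source-slack i a b s d≤a o≤b le = ≤-trans (+-monoˡ-≤ s (+-mono-≤ d≤a o≤b)) (≤-trans le (m≤m+n _ i))

module Transfer (G : Graph n) (lo hi : ℕ) where

  transfer : Fin n → Fin n → Bool
  transfer u w = adj G u w ∧ (deg G u ≤ᵇ lo) ∧ (hi ≤ᵇ deg G w)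

  out in′ : Fin n → ℕ
  out = outflow transfer
  in′ = inflow transfer

  transfer-sound : ∀ {u w} → transfer u w ≡ true → (_~_ G u w) × deg G u ≤ lo × hi ≤ deg G w
  transfer-sound {u} {w} p with u~w , q ← ∧-true {adj G u w} p with l , h ← ∧-true {deg G u ≤ᵇ lo} q =
    u~w , ≤ᵇ-sound l , ≤ᵇ-sound h

  out≤length : ∀ u L → (∀ w → _~_ G u w → deg G u ≤ lo → hi ≤ deg G w → w ∈ L) → out u ≤ length L
  out≤length u L cov = #-⊆list (transfer u) L
    (λ w p → let u~w , l , h = transfer-sound p in cov w u~w l h)

  out≤deg : ∀ u → out u ≤ deg G u
  out≤deg u = ≤-trans (#-cover (transfer u) (adj G u) [] (λ w p → inj₁ (proj₁ (transfer-sound p))))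
                      (≤-reflexive (+-identityʳ _))

  out≤0 : ∀ {u} → lo < deg G u → out u ≤ 0
  out≤0 {u} lo<d = out≤length u [] (λ _ _ d≤lo _ → contradiction d≤lo (<⇒≱ lo<d))

  deg≤in′+length : ∀ v L → hi ≤ deg G v → (∀ y → _~_ G v y → y ∉ L → deg G y ≤ lo) →
                   deg G v ≤ in′ v + length L
  deg≤in′+length v L hi≤d low = #-cover (adj G v) (λ u → transfer u v) L cov
    where
    cov : ∀ y → adj G v y ≡ true → transfer y v ≡ true ⊎ y ∈ L
    cov y v~y with mem? y L
    ... | yes y∈L = inj₂ y∈L
    ... | no y∉L  = inj₁ (∧-intro (~-sym G v~y)
                      (∧-intro (≤ᵇ-complete (low y v~y y∉L)) (≤ᵇ-complete hi≤d)))

≤-via : ∀ {a b} k → a + k ≡ b → a ≤ b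
≤-via k eq = ≤-trans (m≤m+n _ k) (≤-reflexive eq)

module _ (G : Graph n) (conn : Connected G) (6≤n : 6 ≤ n)
         (free : ¬ Contains G (Spider (2 ∷ 2 ∷ 1 ∷ []))) where

  private
    m : ℕ
    m = n ∸ 6
    n≡6+m : n ≡ 6 + m
    n≡6+m = sym (m+[n∸m]≡n 6≤n)
    infix 4 _∼_
    _∼_ = _~_ G
    d = deg G

  -- The ways in which `v` can reach a vertex `x` outside its neighbourhood: through one neighbour
  -- `a` only, through two adjacent ones, or through two nonadjacent ones. In the last case the
  -- graph around `v` lies in a K_{2,m}.
  data Shape₂₂₁ (v : Fin n) : Set where
    one-hub : ∀ {a} → v ∼ a → (∀ {y} → v ∼ y → y ≢ a → ∀ w → y ∼ w → w ∈ v ∷ a ∷ []) → Shape₂₂₁ v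
    diamond : ∀ {a b x} → v ∼ a → v ∼ b → a ∼ b → a ∼ x → b ∼ x → x ≢ v →
      (∀ w → a ∼ w → w ∈ v ∷ b ∷ x ∷ []) → (∀ w → b ∼ w → w ∈ v ∷ a ∷ x ∷ []) →
      (∀ {y} → v ∼ y → y ≢ a → y ≢ b → ∀ w → y ∼ w → w ∈ v ∷ x ∷ []) → Shape₂₂₁ v
    book : ∀ {x} → x ≢ v → ¬ v ∼ x → (∀ {y} → v ∼ y → ∀ w → y ∼ w → w ∈ v ∷ x ∷ []) → Shape₂₂₁ v

  private
    -- Otherwise `v a x` and `v y y′` are disjoint legs, and a neighbour of `v` outside `a`, `y`,
    -- `y′` is the third one.
    leg-ends : ∀ {v a x y y′} → 4 ≤ d v → v ∼ a → a ∼ x → x ≢ v → ¬ v ∼ x →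
      v ∼ y → y ≢ a → y ∼ y′ → y′ ≢ v → y′ ≡ a ⊎ y′ ≡ x
    leg-ends {v} {a} {x} {y} {y′} 4≤d v∼a a∼x x≢v v≁x v∼y y≢a y∼y′ y′≢v with y′ ≟ a | y′ ≟ x
    ... | yes eq | _      = inj₁ eq
    ... | no _   | yes eq = inj₂ eq
    ... | no y′≢a | no y′≢x with e , v∼e , e∉ ← pick G v (a ∷ y ∷ y′ ∷ []) 4≤d =
      contradiction (S₂₂₁-embed G
        ((~⇒≢ G v∼a ∷ ≢-sym x≢v ∷ ~⇒≢ G v∼y ∷ ≢-sym y′≢v ∷ ~⇒≢ G v∼e ∷ [])
         ∷ (~⇒≢ G a∼x ∷ ≢-sym y≢a ∷ ≢-sym y′≢a ∷ (λ eq → e∉ (here (sym eq))) ∷ [])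
         ∷ ((λ { refl → v≁x v∼y }) ∷ ≢-sym y′≢x ∷ (λ { refl → v≁x v∼e }) ∷ [])
         ∷ (~⇒≢ G y∼y′ ∷ (λ eq → e∉ (there (here (sym eq)))) ∷ [])
         ∷ ((λ eq → e∉ (there (there (here (sym eq))))) ∷ [])
         ∷ [] ∷ [])
        v∼a a∼x v∼y y∼y′ v∼e) free

    shape : ∀ v → 4 ≤ d v → Exit G v → Shape₂₂₁ v
    shape v 4≤d (exit {a} {x} v∼a a∼x x≢v v≁x)
      with any? (λ b → (_~?_ G v b) ×-dec (_~?_ G b x) ×-dec ¬? (b ≟ a))
    ... | no ∄ = one-hub v∼a nbrs
      where
      nbrs : ∀ {y} → v ∼ y → y ≢ a → ∀ w → y ∼ w → w ∈ v ∷ a ∷ []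
      nbrs v∼y y≢a w y∼w with w ≟ v
      ... | yes w≡v = here w≡v
      ... | no w≢v with leg-ends 4≤d v∼a a∼x x≢v v≁x v∼y y≢a y∼w w≢v
      ...   | inj₁ w≡a  = there (here w≡a)
      ...   | inj₂ refl = contradiction (_ , v∼y , y∼w , y≢a) ∄
    ... | yes (b , v∼b , b∼x , b≢a) with adj G a b Bool.≟ true
    ...   | yes a∼b = diamond v∼a v∼b a∼b a∼x b∼x x≢v nbrs-a nbrs-b nbrs
      where
      nbrs-a : ∀ w → a ∼ w → w ∈ v ∷ b ∷ x ∷ []
      nbrs-a w a∼w with w ≟ v
      ... | yes w≡v = here w≡v
      ... | no w≢v with leg-ends 4≤d v∼b b∼x x≢v v≁x v∼a (≢-sym b≢a) a∼w w≢v
      ...   | inj₁ w≡b = there (here w≡b)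
      ...   | inj₂ w≡x = there (there (here w≡x))
      nbrs-b : ∀ w → b ∼ w → w ∈ v ∷ a ∷ x ∷ []
      nbrs-b w b∼w with w ≟ v
      ... | yes w≡v = here w≡v
      ... | no w≢v with leg-ends 4≤d v∼a a∼x x≢v v≁x v∼b b≢a b∼w w≢v
      ...   | inj₁ w≡a = there (here w≡a)
      ...   | inj₂ w≡x = there (there (here w≡x))
      -- Either of `v a x` and `v b x` can serve as the fixed leg, so a neighbour other than `v`
      -- lies in both {`a`, `x`} and {`b`, `x`}.
      nbrs : ∀ {y} → v ∼ y → y ≢ a → y ≢ b → ∀ w → y ∼ w → w ∈ v ∷ x ∷ []
      nbrs v∼y y≢a y≢b w y∼w with w ≟ v
      ... | yes w≡v = here w≡v
      ... | no w≢v with leg-ends 4≤d v∼a a∼x x≢v v≁x v∼y y≢a y∼w w≢v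
                      | leg-ends 4≤d v∼b b∼x x≢v v≁x v∼y y≢b y∼w w≢v
      ...   | inj₂ w≡x | _        = there (here w≡x)
      ...   | inj₁ _   | inj₂ w≡x = there (here w≡x)
      ...   | inj₁ w≡a | inj₁ w≡b = contradiction (trans (sym w≡b) w≡a) b≢a
    ...   | no a≁b = book x≢v v≁x nbrs
      where
      nbrs : ∀ {y} → v ∼ y → ∀ w → y ∼ w → w ∈ v ∷ x ∷ []
      nbrs {y} v∼y w y∼w with w ≟ v
      ... | yes w≡v = here w≡v
      ... | no w≢v with y ≟ a | y ≟ b
      ...   | yes refl | yes a≡b = contradiction (sym a≡b) b≢a
      ...   | yes refl | no y≢b with leg-ends 4≤d v∼b b∼x x≢v v≁x v∼y y≢b y∼w w≢v
      ...     | inj₁ refl = contradiction y∼w a≁b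
      ...     | inj₂ w≡x  = there (here w≡x)
      nbrs {y} v∼y w y∼w | no w≢v | no y≢a | _ with leg-ends 4≤d v∼a a∼x x≢v v≁x v∼y y≢a y∼w w≢v
      ...     | inj₂ w≡x  = there (here w≡x)
      ...     | inj₁ refl with y ≟ b
      ...       | yes refl = contradiction (~-sym G y∼w) a≁b
      ...       | no y≢b with leg-ends 4≤d v∼b b∼x x≢v v≁x v∼y y≢b y∼w w≢v
      ...         | inj₁ a≡b = contradiction (sym a≡b) b≢a
      ...         | inj₂ w≡x = there (here w≡x)

    -- The edges avoiding `v` pairwise intersect. Once some `a` other than `v` has degree at least
    -- 3, they all pass through `a` or form a triangle `a b y`.
    universal-bound : ∀ v → Universal G v → ∑ d + 6 ≤ n * 4
    universal-bound v univ = by-cases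
      where
      5≤d : 5 ≤ d v
      5≤d = s≤s⁻¹ (≤-trans 6≤n (universal⇒n≤1+deg G univ))
      d≤ : ∀ u → d u ≤ 5 + m
      d≤ u = s≤s⁻¹ (subst (d u <_) n≡6+m (deg<n G u))
      -- Two disjoint edges avoiding `v` would be the outer edges of two legs, and the fifth
      -- neighbour of `v` is left for the third leg.
      meet : ∀ {p q r s} → p ∼ q → r ∼ s → p ≢ v → q ≢ v → r ≢ v → s ≢ v →
             r ∉ p ∷ q ∷ [] → s ∈ p ∷ q ∷ []
      meet {p} {q} {r} {s} p∼q r∼s p≢v q≢v r≢v s≢v r∉ = decidable-stable (mem? s (p ∷ q ∷ [])) λ s∉ →
        let e , v∼e , e∉ = pick G v (p ∷ q ∷ r ∷ s ∷ []) 5≤d in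
        free (S₂₂₁-embed G
          ((≢-sym p≢v ∷ ≢-sym q≢v ∷ ≢-sym r≢v ∷ ≢-sym s≢v ∷ ~⇒≢ G v∼e ∷ [])
           ∷ (~⇒≢ G p∼q ∷ (λ eq → r∉ (here (sym eq))) ∷ (λ eq → s∉ (here (sym eq))) ∷ (λ eq → e∉ (here (sym eq))) ∷ [])
           ∷ ((λ eq → r∉ (there (here (sym eq)))) ∷ (λ eq → s∉ (there (here (sym eq)))) ∷ (λ eq → e∉ (there (here (sym eq)))) ∷ [])
           ∷ (~⇒≢ G r∼s ∷ (λ eq → e∉ (there (there (here (sym eq))))) ∷ [])
           ∷ ((λ eq → e∉ (there (there (there (here (sym eq)))))) ∷ [])
           ∷ [] ∷ [])
          (univ p p≢v) p∼q (univ r r≢v) r∼s v∼e)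
      by-cases : ∑ d + 6 ≤ n * 4
      by-cases with any? (λ u → ¬? (u ≟ v) ×-dec (3 ≤? d u))
      ... | no ∄ = begin
        ∑ d + 6               ≤⟨ +-monoˡ-≤ 6 (m≤m+n (∑ d) 0) ⟩
        ∑ d + 0 + 6           ≤⟨ +-monoˡ-≤ 6 (bounded d 2 ((v , 5 + m) ∷ []) []
                                   (λ u u∉ → ≮⇒≥ (λ 2<d → ∄ (u , u∉ ∘ here , 2<d)))
                                   (≤-trans (d≤ v) (m≤n+m _ 2) ∷ []) [] []) ⟩
        n * 2 + (5 + m + 0) + 6  ≤⟨ subst (λ k → k * 2 + (5 + m + 0) + 6 ≤ k * 4) (sym n≡6+m) (≤-via (1 + m) (arith m)) ⟩
        n * 4                 ∎
        where
        open ≤-Reasoning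
        arith : ∀ m → (6 + m) * 2 + (5 + m + 0) + 6 + (1 + m) ≡ (6 + m) * 4
        arith = solve-∀
      ... | yes (a , a≢v , 3≤d) with pickMany G 2 a (v ∷ []) 3≤d
      ...   | b ∷ y ∷ [] , refl , (b≢y ∷ []) ∷ _ , a∼b ∷ a∼y ∷ [] , (b≢v ∷ []) ∷ (y≢v ∷ []) ∷ []
        with adj G b y Bool.≟ true
      ...     | no b≁y = begin
        ∑ d + 6               ≤⟨ +-monoˡ-≤ 6 (m≤m+n (∑ d) 0) ⟩
        -- The extremal case K_{1,1,n-2}: `v` and `a` have degree n - 1 = 2 + (3 + `m`) and all
        -- others degree 2, so no margin is left.
        ∑ d + 0 + 6           ≤⟨ +-monoˡ-≤ 6 (bounded d 2 ((v , 3 + m) ∷ (a , 3 + m) ∷ []) []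
                                   (λ u u∉ → deg≤ G u (v ∷ a ∷ []) (nbrs u u∉))
                                   (d≤ v ∷ d≤ a ∷ []) [] []) ⟩
        n * 2 + (3 + m + (3 + m + 0)) + 6  ≡⟨ subst (λ k → k * 2 + (3 + m + (3 + m + 0)) + 6 ≡ k * 4) (sym n≡6+m) (arith m) ⟩
        n * 4                 ∎
        where
        open ≤-Reasoning
        arith : ∀ m → (6 + m) * 2 + (3 + m + (3 + m + 0)) + 6 ≡ (6 + m) * 4
        arith = solve-∀
        nbrs : ∀ u → u ∉ v ∷ a ∷ [] → ∀ w → u ∼ w → w ∈ v ∷ a ∷ []
        nbrs u u∉ w u∼w with w ≟ v | w ≟ a
        ... | yes w≡v | _       = here w≡v
        ... | no _    | yes w≡a = there (here w≡a)
        ... | no w≢v  | no w≢a  with u ≟ b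
        ...   | yes refl with meet a∼y u∼w a≢v y≢v b≢v w≢v (λ { (here b≡a) → u∉ (there (here b≡a)) ; (there (here b≡y)) → b≢y b≡y })
        ...     | here w≡a          = contradiction w≡a w≢a
        ...     | there (here refl) = contradiction u∼w b≁y
        nbrs u u∉ w u∼w | no w≢v | no w≢a | no u≢b
          with meet a∼b u∼w a≢v b≢v (u∉ ∘ here) w≢v (λ { (here u≡a) → u∉ (there (here u≡a)) ; (there (here u≡b)) → u≢b u≡b })
        ... | here w≡a = contradiction w≡a w≢a
        ... | there (here refl) with u ≟ y
        ...   | yes refl = contradiction (~-sym G u∼w) b≁y
        ...   | no u≢y with meet a∼y u∼w a≢v y≢v (u∉ ∘ here) w≢v (λ { (here u≡a) → u∉ (there (here u≡a)) ; (there (here u≡y)) → u≢y u≡y })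
        ...     | here w≡a         = contradiction w≡a w≢a
        ...     | there (here b≡y) = contradiction b≡y b≢y
      by-cases | yes (a , a≢v , 3≤d) | b ∷ y ∷ [] , refl , (b≢y ∷ []) ∷ _ , a∼b ∷ a∼y ∷ [] , (b≢v ∷ []) ∷ (y≢v ∷ []) ∷ [] | yes b∼y = begin
        ∑ d + 6               ≤⟨ +-monoˡ-≤ 6 (m≤m+n (∑ d) 0) ⟩
        ∑ d + 0 + 6           ≤⟨ +-monoˡ-≤ 6 (bounded d 2 ((v , 3 + m) ∷ (a , 1) ∷ (b , 1) ∷ (y , 1) ∷ []) []
                                   (λ u u∉ → deg≤ G u (v ∷ a ∷ []) (nbrs u u∉))
                                   (d≤ v ∷ deg≤ G a (v ∷ b ∷ y ∷ []) (triangle b∼y a≢v b≢v y≢v (~⇒≢ G a∼b) (~⇒≢ G a∼y))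
                                         ∷ deg≤ G b (v ∷ a ∷ y ∷ []) (triangle a∼y b≢v a≢v y≢v (≢-sym (~⇒≢ G a∼b)) b≢y)
                                         ∷ deg≤ G y (v ∷ a ∷ b ∷ []) (triangle a∼b y≢v a≢v b≢v (≢-sym (~⇒≢ G a∼y)) (≢-sym b≢y)) ∷ []) [] []) ⟩
        n * 2 + (3 + m + 3) + 6  ≤⟨ subst (λ k → k * 2 + (3 + m + 3) + 6 ≤ k * 4) (sym n≡6+m) (≤-via m (arith m)) ⟩
        n * 4                 ∎
        where
        open ≤-Reasoning
        arith : ∀ m → (6 + m) * 2 + (3 + m + 3) + 6 + m ≡ (6 + m) * 4
        arith = solve-∀
        triangle : ∀ {p q r} → q ∼ r → p ≢ v → q ≢ v → r ≢ v → p ≢ q → p ≢ r → ∀ w → p ∼ w → w ∈ v ∷ q ∷ r ∷ []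
        triangle q∼r p≢v q≢v r≢v p≢q p≢r w p∼w with w ≟ v
        ... | yes w≡v = here w≡v
        ... | no w≢v  = there (meet q∼r p∼w q≢v r≢v p≢v w≢v (λ { (here eq) → p≢q eq ; (there (here eq)) → p≢r eq }))
        nbrs : ∀ u → u ∉ v ∷ a ∷ b ∷ y ∷ [] → ∀ w → u ∼ w → w ∈ v ∷ a ∷ []
        nbrs u u∉ w u∼w with w ≟ v
        ... | yes w≡v = here w≡v
        ... | no w≢v with meet a∼b u∼w a≢v b≢v (u∉ ∘ here) w≢v (λ { (here eq) → u∉ (there (here eq)) ; (there (here eq)) → u∉ (there (there (here eq))) })
                        | meet a∼y u∼w a≢v y≢v (u∉ ∘ here) w≢v (λ { (here eq) → u∉ (there (here eq)) ; (there (here eq)) → u∉ (there (there (there (here eq)))) })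
        ...   | here w≡a         | _                = there (here w≡a)
        ...   | there (here _)   | here w≡a         = there (here w≡a)
        ...   | there (here w≡b) | there (here w≡y) = contradiction (trans (sym w≡b) w≡y) b≢y

    open Transfer G 2 4

    Slack : Fin n × ℕ → Set
    Slack (u , s) = d u + out u + s ≤ 4 + in′ u

    retains : ∀ {v y} → d y ≤ 2 → (∀ w → y ∼ w → 4 ≤ d w → w ∈ v ∷ []) → Slack (y , 1)
    retains {v} {y} d≤2 only = source-slack (in′ y) 2 1 1 d≤2 (out≤length y (v ∷ []) (λ w y∼w _ → only w y∼w)) (m≤m+n 4 0)

    -- With degree at most 2 the charge is at least 2, and only `v` can claim a unit of it.
    two-nbrs-slack : ∀ {v a y} → (∀ w → y ∼ w → w ∈ v ∷ a ∷ []) → ¬ 4 ≤ d a → Slack (y , 1)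
    two-nbrs-slack {v} {a} {y} nbrs small = retains (deg≤ G y (v ∷ a ∷ []) nbrs) only
      where
      only : ∀ w → y ∼ w → 4 ≤ d w → w ∈ v ∷ []
      only w y∼w 4≤d with nbrs w y∼w
      ... | here w≡v          = here w≡v
      ... | there (here refl) = contradiction 4≤d small

    -- All neighbours of `v` but possibly `a` have degree at most 2 and pay, which leaves 4 - 1.
    one-hub-slack : ∀ {v a} → 4 ≤ d v → (∀ {y} → v ∼ y → y ≢ a → ∀ w → y ∼ w → w ∈ v ∷ a ∷ []) → Slack (v , 3)
    one-hub-slack {v} {a} 4≤d nbrs = sink-slack 4 1 3
      (deg≤in′+length v (a ∷ []) 4≤d (λ y v∼y y∉ → deg≤ G y (v ∷ a ∷ []) (nbrs v∼y (y∉ ∘ here))))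
      (out≤0 (<⇒≤ 4≤d)) ≤-refl

    -- The worst shape is the diamond, where `a` and `b` have degree 3 and do not pay.
    hub-slack : ∀ {v} → 4 ≤ d v → Shape₂₂₁ v → Slack (v , 2)
    hub-slack {v} 4≤d (one-hub _ nbrs) = ≤-trans (+-monoʳ-≤ (d v + out v) (n≤1+n 2)) (one-hub-slack 4≤d nbrs)
    hub-slack {v} 4≤d (diamond {a} {b} {x} _ _ _ _ _ _ _ _ nbrs) =
      sink-slack 4 2 2 (deg≤in′+length v (a ∷ b ∷ []) 4≤d
                   (λ y v∼y y∉ → deg≤ G y (v ∷ x ∷ []) (nbrs v∼y (y∉ ∘ here) (y∉ ∘ there ∘ here))))
                 (out≤0 (<⇒≤ 4≤d)) ≤-refl
    hub-slack {v} 4≤d (book {x} _ _ nbrs) =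
      sink-slack 4 0 2 (deg≤in′+length v [] 4≤d (λ y v∼y _ → deg≤ G y (v ∷ x ∷ []) (nbrs v∼y)))
                 (out≤0 (<⇒≤ 4≤d)) (m≤n+m 2 2)

    module NoUniversal (shapes : ∀ {v} → 4 ≤ d v → Shape₂₂₁ v) where

      balanced : ∀ u → d u + out u ≤ 4 + in′ u
      balanced u with 4 ≤? d u | 3 ≤? d u
      ... | yes 4≤d | _       = ≤-trans (m≤m+n _ 2) (hub-slack 4≤d (shapes 4≤d))
      ... | no 4≰d  | yes 3≤d = ≤-trans (m≤m+n _ 0) (source-slack (in′ u) 3 0 0 (≮⇒≥ 4≰d) (out≤0 3≤d) (n≤1+n 3))
      ... | no _    | no 3≰d  = ≤-trans (m≤m+n _ 0)
        (source-slack (in′ u) 2 2 0 (≮⇒≥ 3≰d) (≤-trans (out≤deg u) (≮⇒≥ 3≰d)) ≤-refl)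

      finish : (L : List (Fin n × ℕ)) → sum (map proj₂ L) ≡ 6 → Unique (map proj₁ L) → All Slack L → ∑ d + 6 ≤ n * 4
      finish L total uniq slack = begin
        ∑ d + 6                    ≡⟨ cong (∑ d +_) (sym total) ⟩
        ∑ d + sum (map proj₂ L)    ≤⟨ discharge transfer d 4 [] L (λ u _ → balanced u) [] uniq slack ⟩
        n * 4 + 0                  ≡⟨ +-identityʳ _ ⟩
        n * 4                      ∎
        where open ≤-Reasoning

      private
        triangle-slack : ∀ {p q r s} → p ∼ q → p ∼ r → p ∼ s → Unique (q ∷ r ∷ s ∷ []) →
          (∀ w → p ∼ w → w ∈ q ∷ r ∷ s ∷ []) → Slack (p , 1)
        triangle-slack {p} {q} {r} {s} p∼q p∼r p∼s uniq nbrs =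
          source-slack (in′ p) 3 0 1 (deg≤ G p _ nbrs)
            (out≤0 (list⊆-# (adj G p) _ uniq (p∼q ∷ p∼r ∷ p∼s ∷ []))) ≤-refl

      -- `v` keeps 2 and `a`, `b` keep 1 each. The missing 2 is the surplus of `x` if `x` has degree
      -- at least 4; otherwise two more neighbours of `v` have nobody but `v` to pay and keep 1
      -- each.
      diamond-bound : ∀ {v a b x} → 4 ≤ d v → v ∼ a → v ∼ b → a ∼ b → a ∼ x → b ∼ x → x ≢ v →
        (∀ w → a ∼ w → w ∈ v ∷ b ∷ x ∷ []) → (∀ w → b ∼ w → w ∈ v ∷ a ∷ x ∷ []) →
        (∀ {y} → v ∼ y → y ≢ a → y ≢ b → ∀ w → y ∼ w → w ∈ v ∷ x ∷ []) → ∑ d + 6 ≤ n * 4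
      diamond-bound {v} {a} {b} {x} 4≤d v∼a v∼b a∼b a∼x b∼x x≢v nbrs-a nbrs-b nbrs
        with slack-v ← hub-slack 4≤d (diamond v∼a v∼b a∼b a∼x b∼x x≢v nbrs-a nbrs-b nbrs)
           | slack-a ← triangle-slack (~-sym G v∼a) a∼b a∼x ((~⇒≢ G v∼b ∷ ≢-sym x≢v ∷ []) ∷ (~⇒≢ G b∼x ∷ []) ∷ [] ∷ []) nbrs-a
           | slack-b ← triangle-slack (~-sym G v∼b) (~-sym G a∼b) b∼x ((~⇒≢ G v∼a ∷ ≢-sym x≢v ∷ []) ∷ (~⇒≢ G a∼x ∷ []) ∷ [] ∷ []) nbrs-b
           | 4 ≤? d x
      ... | yes 4≤dx = finish ((v , 2) ∷ (a , 1) ∷ (b , 1) ∷ (x , 2) ∷ []) refl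
        ((~⇒≢ G v∼a ∷ ~⇒≢ G v∼b ∷ ≢-sym x≢v ∷ []) ∷ (~⇒≢ G a∼b ∷ ~⇒≢ G a∼x ∷ []) ∷ (~⇒≢ G b∼x ∷ []) ∷ [] ∷ [])
        (slack-v ∷ slack-a ∷ slack-b ∷ hub-slack 4≤dx (shapes 4≤dx) ∷ [])
      ... | no x-small with pickMany G 2 v (a ∷ b ∷ []) 4≤d
      ...   | y ∷ z ∷ [] , refl , (y≢z ∷ []) ∷ _ , v∼y ∷ v∼z ∷ [] , (y≢a ∷ y≢b ∷ []) ∷ (z≢a ∷ z≢b ∷ []) ∷ [] =
        finish ((v , 2) ∷ (a , 1) ∷ (b , 1) ∷ (y , 1) ∷ (z , 1) ∷ []) refl
          ((~⇒≢ G v∼a ∷ ~⇒≢ G v∼b ∷ ~⇒≢ G v∼y ∷ ~⇒≢ G v∼z ∷ []) ∷ (~⇒≢ G a∼b ∷ ≢-sym y≢a ∷ ≢-sym z≢a ∷ [])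
            ∷ (≢-sym y≢b ∷ ≢-sym z≢b ∷ []) ∷ (y≢z ∷ []) ∷ [] ∷ [])
          (slack-v ∷ slack-a ∷ slack-b ∷ two-nbrs-slack (nbrs v∼y y≢a y≢b) x-small
            ∷ two-nbrs-slack (nbrs v∼z z≢a z≢b) x-small ∷ [])

      -- Every neighbour of `v` pays, so `v` keeps 4; the missing 2 comes from the same alternative
      -- for `x` as in the diamond.
      book-bound : ∀ {v x} → 4 ≤ d v → x ≢ v → ¬ v ∼ x →
        (∀ {y} → v ∼ y → ∀ w → y ∼ w → w ∈ v ∷ x ∷ []) → ∑ d + 6 ≤ n * 4
      book-bound {v} {x} 4≤d x≢v v≁x nbrs with 4 ≤? d x
        | sink-slack 4 0 4 (deg≤in′+length v [] 4≤d (λ y v∼y _ → deg≤ G y (v ∷ x ∷ []) (nbrs v∼y))) (out≤0 (<⇒≤ 4≤d)) ≤-refl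
      ... | yes 4≤dx | slack-v = finish ((v , 4) ∷ (x , 2) ∷ []) refl ((≢-sym x≢v ∷ []) ∷ [] ∷ [])
        (slack-v ∷ hub-slack 4≤dx (shapes 4≤dx) ∷ [])
      ... | no x-small | slack-v with pickMany G 2 v [] (<⇒≤ (<⇒≤ 4≤d))
      ...   | y ∷ z ∷ [] , refl , (y≢z ∷ []) ∷ _ , v∼y ∷ v∼z ∷ [] , _ =
        finish ((v , 4) ∷ (y , 1) ∷ (z , 1) ∷ []) refl
          ((~⇒≢ G v∼y ∷ ~⇒≢ G v∼z ∷ []) ∷ (y≢z ∷ []) ∷ [] ∷ [])
          (slack-v ∷ two-nbrs-slack (nbrs v∼y) x-small ∷ two-nbrs-slack (nbrs v∼z) x-small ∷ [])

      bound : ∑ d + 6 ≤ n * 4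
      bound with any? (λ v → 4 ≤? d v)
      ... | no ∄ = begin
        ∑ d + 6       ≤⟨ +-mono-≤ (≤-trans (m≤m+n (∑ d) 0) (bounded d 3 [] [] (λ u _ → ≮⇒≥ (λ 4≤d → ∄ (u , 4≤d))) [] [] [])) 6≤n ⟩
        n * 3 + 0 + n ≡⟨ arith n ⟩
        n * 4         ∎
        where
        open ≤-Reasoning
        arith : ∀ n → n * 3 + 0 + n ≡ n * 4
        arith = solve-∀
      ... | yes (v , 4≤d) with shapes 4≤d
      ...   | diamond v∼a v∼b a∼b a∼x b∼x x≢v nbrs-a nbrs-b nbrs = diamond-bound 4≤d v∼a v∼b a∼b a∼x b∼x x≢v nbrs-a nbrs-b nbrs
      ...   | book x≢v v≁x nbrs = book-bound 4≤d x≢v v≁x nbrs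
      ...   | one-hub {a} v∼a nbrs with one-hub-slack 4≤d nbrs | 4 ≤? d a
      ...     | slack-v | no a-small with pickMany G 3 v (a ∷ []) 4≤d
      ...       | x ∷ y ∷ z ∷ [] , refl , uniq , v∼x ∷ v∼y ∷ v∼z ∷ [] , (x≢a ∷ []) ∷ (y≢a ∷ []) ∷ (z≢a ∷ []) ∷ [] =
        finish ((v , 3) ∷ (x , 1) ∷ (y , 1) ∷ (z , 1) ∷ []) refl
          ((~⇒≢ G v∼x ∷ ~⇒≢ G v∼y ∷ ~⇒≢ G v∼z ∷ []) ∷ uniq)
          (slack-v ∷ two-nbrs-slack (nbrs v∼x x≢a) a-small ∷ two-nbrs-slack (nbrs v∼y y≢a) a-small
            ∷ two-nbrs-slack (nbrs v∼z z≢a) a-small ∷ [])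
      -- If `a` has degree at least 4 as well, its own shape decides; two shapes with one hub
      -- contribute 3 + 3.
      bound | yes (v , 4≤d) | one-hub {a} v∼a nbrs | slack-v | yes 4≤da with shapes 4≤da
      ...       | diamond v∼a v∼b a∼b a∼x b∼x x≢v nbrs-a nbrs-b nbrs′ = diamond-bound 4≤da v∼a v∼b a∼b a∼x b∼x x≢v nbrs-a nbrs-b nbrs′
      ...       | book x≢v v≁x nbrs′ = book-bound 4≤da x≢v v≁x nbrs′
      ...       | one-hub _ nbrs′ =
        finish ((v , 3) ∷ (a , 3) ∷ []) refl ((~⇒≢ G v∼a ∷ []) ∷ [] ∷ []) (slack-v ∷
          one-hub-slack 4≤da nbrs′ ∷ [])

  S₂₂₁-free⇒∑deg≤ : ∑ (deg G) + 6 ≤ n * 4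
  S₂₂₁-free⇒∑deg≤ with any? (λ v → (4 ≤? d v) ×-dec universal? v)
    where
    universal? : ∀ v → Dec (Universal G v)
    universal? v with universal-or-exit G conn v
    ... | inj₁ univ = yes univ
    ... | inj₂ (exit {x = x} _ _ x≢v v≁x) = no (λ univ → v≁x (univ x x≢v))
  ... | yes (v , _ , univ) = universal-bound v univ
  ... | no ∄ = NoUniversal.bound (λ {v} 4≤d → [ (λ univ → contradiction (v , 4≤d , univ) ∄) , shape v 4≤d ]′ (universal-or-exit G conn v))

-- Upper bound for S_{3,1,1}

module _ (G : Graph n) where

  private
    infix 4 _∼_
    _∼_ = _~_ G

  outside : Fin n → Fin n → Bool
  outside v u = not (adj G v u) ∧ not (does (u ≟ v))

  outside-sound : ∀ {v u} → outside v u ≡ true → u ≢ v × ¬ v ∼ u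
  outside-sound {v} {u} p with adj G v u | u ≟ v
  ... | false | no u≢v = u≢v , λ ()

  outside-complete : ∀ {v u} → u ≢ v → ¬ v ∼ u → outside v u ≡ true
  outside-complete {v} {u} u≢v v≁u with adj G v u | u ≟ v
  ... | true  | _       = contradiction refl v≁u
  ... | false | yes u≡v = contradiction u≡v u≢v
  ... | false | no _    = refl

  outside-root : ∀ v → ⟦ outside v v ⟧ ≡ 0
  outside-root v with outside v v in p
  ... | false = refl
  ... | true  = contradiction refl (proj₁ (outside-sound p))

  outside-nbr : ∀ {v u} → v ∼ u → ⟦ outside v u ⟧ ≡ 0
  outside-nbr {v} {u} v∼u with outside v u in p
  ... | false = refl
  ... | true  = contradiction v∼u (proj₂ (outside-sound {v} {u} p))

  n≤#outside+deg+1 : ∀ v → n ≤ # (outside v) + (deg G v + 1)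
  n≤#outside+deg+1 v = begin
    n                                       ≡⟨ sym (*-identityʳ n) ⟩
    n * 1                                   ≡⟨ sym (∑-const n 1) ⟩
    #_ {n} (λ _ → true)                     ≤⟨ #-cover (λ _ → true) (λ u → outside v u ∨ adj G v u) (v ∷ []) cov ⟩
    # (λ u → outside v u ∨ adj G v u) + 1   ≤⟨ +-monoˡ-≤ 1 (∑-mono (λ u → ⟦∨⟧≤ (outside v u) (adj G v u))) ⟩
    ∑ (λ u → ⟦ outside v u ⟧ + ⟦ adj G v u ⟧) + 1  ≡⟨ cong (_+ 1) (∑-distrib-+ (⟦_⟧ ∘ outside v) (⟦_⟧ ∘ adj G v)) ⟩
    # (outside v) + deg G v + 1             ≡⟨ +-assoc (# (outside v)) (deg G v) 1 ⟩
    # (outside v) + (deg G v + 1)           ∎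
    where
    open ≤-Reasoning
    cov : ∀ u → true ≡ true → outside v u ∨ adj G v u ≡ true ⊎ u ∈ v ∷ []
    cov u _ with u ≟ v
    ... | yes u≡v = inj₂ (here u≡v)
    ... | no _    = inj₁ (excluded-middle (adj G v u))
      where
      excluded-middle : ∀ b → (not b ∧ true) ∨ b ≡ true
      excluded-middle true  = refl
      excluded-middle false = refl

  data Near (v : Fin n) : Fin n → Set where
    root : Near v v
    nbr  : ∀ {u} → v ∼ u → Near v u
    far  : ∀ {u a} → v ∼ a → a ∼ u → u ≢ v → ¬ v ∼ u → Near v u

  -- When all neighbours of vertices at distance two lie in N(`v`), no walk from `v` gets any
  -- further.
  all-near : Connected G → ∀ v →
    (∀ {a u w} → v ∼ a → a ∼ u → u ≢ v → ¬ v ∼ u → u ∼ w → v ∼ w) → ∀ u → Near v u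
  all-near conn v closed u = walk root (conn v u)
    where
    extend : ∀ {u w} → Near v u → u ∼ w → Near v w
    extend root v∼w = nbr v∼w
    extend {u} {w} (nbr v∼u) u∼w with w ≟ v | (G ~? v) w
    ... | yes refl | _       = root
    ... | no _     | yes v∼w = nbr v∼w
    ... | no w≢v   | no v≁w  = far v∼u u∼w w≢v v≁w
    extend (far v∼a a∼u u≢v v≁u) u∼w = nbr (closed v∼a a∼u u≢v v≁u u∼w)
    walk : ∀ {u w} → Near v u → Reach G u w → Near v w
    walk near here         = near
    walk near (step u∼w r) = walk (extend near u∼w) r

module _ (G : Graph n) (conn : Connected G) (free : ¬ Contains G (Spider (3 ∷ 1 ∷ 1 ∷ []))) where

  private
    infix 4 _∼_
    _∼_ = _~_ G
    d = deg G

    no-path : ∀ {v a b c e f} → v ∼ a → a ∼ b → b ∼ c → b ≢ v → c ≢ v → c ≢ a →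
      v ∼ e → v ∼ f → e ≢ f → All (e ≢_) (a ∷ b ∷ c ∷ []) → All (f ≢_) (a ∷ b ∷ c ∷ []) → ⊥
    no-path v∼a a∼b b∼c b≢v c≢v c≢a v∼e v∼f e≢f (e≢a ∷ e≢b ∷ e≢c ∷ []) (f≢a ∷ f≢b ∷ f≢c ∷ []) =
      free (S₃₁₁-embed G
        ((~⇒≢ G v∼a ∷ ≢-sym b≢v ∷ ≢-sym c≢v ∷ ~⇒≢ G v∼e ∷ ~⇒≢ G v∼f ∷ [])
         ∷ (~⇒≢ G a∼b ∷ ≢-sym c≢a ∷ ≢-sym e≢a ∷ ≢-sym f≢a ∷ [])
         ∷ (~⇒≢ G b∼c ∷ ≢-sym e≢b ∷ ≢-sym f≢b ∷ [])
         ∷ (≢-sym e≢c ∷ ≢-sym f≢c ∷ []) ∷ (e≢f ∷ []) ∷ [] ∷ [])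
        v∼a a∼b b∼c v∼e v∼f)

    ∼≁⇒≢ : ∀ {v u w} → v ∼ u → ¬ v ∼ w → u ≢ w
    ∼≁⇒≢ v∼u v≁w refl = v≁w v∼u

  module HighDegree {v : Fin n} (5≤d : 5 ≤ d v) where

    private
      -- Neighbours of `v` pay `v`, and vertices outside pay each of their neighbours. Thus `v`
      -- recovers its whole degree and ends with 3, the required surplus.
      t : Fin n → Fin n → Bool
      t u w = adj G u w ∧ (does (w ≟ v) ∨ outside G v u)

      -- A further neighbour `w` would make `v a b w` a leg, and five neighbours leave `v` two
      -- outside `a`, `b`, `w`.
      nbrs : ∀ {a b} → v ∼ a → a ∼ b → b ≢ v → ∀ w → b ∼ w → w ∈ v ∷ a ∷ []
      nbrs {a} {b} v∼a a∼b b≢v w b∼w = decidable-stable (mem? w (v ∷ a ∷ [])) λ w∉ →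
        case pickMany G 2 v (a ∷ b ∷ w ∷ []) 5≤d of λ
          { (e ∷ f ∷ [] , refl , (e≢f ∷ []) ∷ _ , v∼e ∷ v∼f ∷ [] , e≢ ∷ f≢ ∷ []) →
            no-path v∼a a∼b b∼w b≢v (w∉ ∘ here) (w∉ ∘ there ∘ here) v∼e v∼f e≢f e≢ f≢ }

      far-nbrs : ∀ {a u} → v ∼ a → a ∼ u → u ≢ v → ¬ v ∼ u → ∀ w → u ∼ w → w ∈ a ∷ []
      far-nbrs v∼a a∼u u≢v v≁u w u∼w with nbrs v∼a a∼u u≢v w u∼w
      ... | here refl = contradiction (~-sym G u∼w) v≁u
      ... | there w∈  = w∈

      near : ∀ u → Near G v u
      near = all-near G conn v λ v∼a a∼u u≢v v≁u u∼w → case far-nbrs v∼a a∼u u≢v v≁u _ u∼w of λ { (here refl) → v∼a }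

      t-sound : ∀ {u w} → t u w ≡ true → u ∼ w × (w ≡ v ⊎ (u ≢ v × ¬ v ∼ u))
      t-sound {u} {w} p with u∼w , q ← ∧-true {adj G u w} p with w ≟ v
      ... | yes w≡v = u∼w , inj₁ w≡v
      ... | no _    = u∼w , inj₂ (outside-sound G q)

      out-nbr : ∀ u → v ∼ u → outflow t u ≤ 1
      out-nbr u v∼u = #-⊆list (t u) (v ∷ []) λ w p → case t-sound p of λ
        { (_ , inj₁ w≡v) → here w≡v ; (_ , inj₂ (_ , v≁u)) → contradiction v∼u v≁u }

      t-root : ∀ u → v ∼ u → t u v ≡ true
      t-root u v∼u = ∧-intro (~-sym G v∼u) (∨-introˡ (is-root v))
        where
        is-root : ∀ v → does (v ≟ v) ≡ true
        is-root v with v ≟ v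
        ... | yes _  = refl
        ... | no v≢v = contradiction refl v≢v

      root-slack : d v + outflow t v + 3 ≤ 3 + inflow t v
      root-slack = sink-slack 3 0 3
        (#-cover (adj G v) (λ u → t u v) [] (λ u v∼u → inj₁ (t-root u v∼u)))
        (#-⊆list (t v) [] λ w p → case t-sound p of λ
          { (v∼v , inj₁ refl) → contradiction refl (~⇒≢ G v∼v)
          ; (_ , inj₂ (v≢v , _)) → contradiction refl v≢v })
        ≤-refl

      -- If `u` has a neighbour `a` in N(`v`), then `nbrs` leaves it only `v` and `a`. Otherwise all
      -- its neighbours but `v` are outside and pay it.
      nbr-balanced : ∀ u → v ∼ u → d u + outflow t u ≤ 3 + inflow t u
      nbr-balanced u v∼u with any? (λ a → ((G ~? u) a) ×-dec ((G ~? v) a))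
      ... | yes (a , u∼a , v∼a) = ≤-trans (m≤m+n _ 0) (source-slack (inflow t u) 2 1 0
        (deg≤ G u (v ∷ a ∷ []) (nbrs v∼a (~-sym G u∼a) (≢-sym (~⇒≢ G v∼u)))) (out-nbr u v∼u) ≤-refl)
      ... | no ∄ = begin
        d u + outflow t u      ≤⟨ +-mono-≤ (#-cover (adj G u) (λ w → t w u) (v ∷ []) cov) (out-nbr u v∼u) ⟩
        inflow t u + 1 + 1     ≤⟨ ≤-via 1 (arith (inflow t u)) ⟩
        3 + inflow t u         ∎
        where
        open ≤-Reasoning
        arith : ∀ i → i + 1 + 1 + 1 ≡ 3 + i
        arith = solve-∀
        cov : ∀ w → u ∼ w → t w u ≡ true ⊎ w ∈ v ∷ []
        cov w u∼w with mem? w (v ∷ [])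
        ... | yes w∈ = inj₂ w∈
        ... | no w∉  = inj₁ (∧-intro (~-sym G u∼w) (∨-introʳ {does (u ≟ v)}
                          (outside-complete G (w∉ ∘ here) (λ v∼w → ∄ (w , u∼w , v∼w)))))

      balanced : ∀ u → d u + outflow t u ≤ 3 + inflow t u
      balanced u with near u
      ... | root    = ≤-trans (m≤m+n _ 3) root-slack
      ... | nbr v∼u = nbr-balanced u v∼u
      ... | far {a = a} v∼a a∼u u≢v v≁u = ≤-trans (m≤m+n _ 0) (source-slack (inflow t u) 1 1 0
        (deg≤ G u (a ∷ []) (far-nbrs v∼a a∼u u≢v v≁u))
        (#-⊆list (t u) (a ∷ []) (λ w p → far-nbrs v∼a a∼u u≢v v≁u w (proj₁ (t-sound p)))) (n≤1+n 2))

    bound : ∑ d + 3 ≤ n * 3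
    bound = ≤-trans (discharge t d 3 [] ((v , 3) ∷ []) (λ u _ → balanced u) [] ([] ∷ []) (root-slack ∷ []))
                    (≤-reflexive (+-identityʳ _))

  module DegreeFour (6≤n : 6 ≤ n) {v : Fin n} (4≤d : 4 ≤ d v) (d≤4 : d v ≤ 4) where

    private
      t : Fin n → Fin n → Bool
      t u w = adj G u w ∧ outside G v u

      -- Since `u` is not adjacent to `v`, four neighbours of `v` already leave two besides `a` and
      -- `w`. Vertices at distance two are therefore pendant.
      far-nbrs : ∀ {a u} → v ∼ a → a ∼ u → u ≢ v → ¬ v ∼ u → ∀ w → u ∼ w → w ∈ a ∷ []
      far-nbrs {a} {u} v∼a a∼u u≢v v≁u w u∼w = decidable-stable (mem? w (a ∷ [])) λ w∉ →
        case pickMany G 2 v (a ∷ w ∷ []) 4≤d of λ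
          { (e ∷ f ∷ [] , refl , (e≢f ∷ []) ∷ _ , v∼e ∷ v∼f ∷ [] , (e≢a ∷ e≢w ∷ []) ∷ (f≢a ∷ f≢w ∷ []) ∷ []) →
            no-path v∼a a∼u u∼w u≢v (λ { refl → v≁u (~-sym G u∼w) }) (w∉ ∘ here) v∼e v∼f e≢f
              (e≢a ∷ ∼≁⇒≢ v∼e v≁u ∷ e≢w ∷ []) (f≢a ∷ ∼≁⇒≢ v∼f v≁u ∷ f≢w ∷ []) }

      -- Otherwise v, b, a, x is a leg with three edges.
      exit-nbrs : ∀ {a x b} → v ∼ a → a ∼ x → x ≢ v → ¬ v ∼ x → v ∼ b → ¬ a ∼ b
      exit-nbrs {a} {x} {b} v∼a a∼x x≢v v≁x v∼b a∼b =
        case pickMany G 2 v (b ∷ a ∷ []) 4≤d of λ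
          { (e ∷ f ∷ [] , refl , (e≢f ∷ []) ∷ _ , v∼e ∷ v∼f ∷ [] , (e≢b ∷ e≢a ∷ []) ∷ (f≢b ∷ f≢a ∷ []) ∷ []) →
            no-path v∼b (~-sym G a∼b) a∼x (≢-sym (~⇒≢ G v∼a)) x≢v (≢-sym (∼≁⇒≢ v∼b v≁x)) v∼e v∼f e≢f
              (e≢b ∷ e≢a ∷ ∼≁⇒≢ v∼e v≁x ∷ []) (f≢b ∷ f≢a ∷ ∼≁⇒≢ v∼f v≁x ∷ []) }

      near : ∀ u → Near G v u
      near = all-near G conn v λ v∼a a∼u u≢v v≁u u∼w → case far-nbrs v∼a a∼u u≢v v≁u _ u∼w of λ { (here refl) → v∼a }

      t-sound : ∀ {u w} → t u w ≡ true → u ∼ w × (u ≢ v × ¬ v ∼ u)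
      t-sound {u} {w} p with u∼w , q ← ∧-true {adj G u w} p = u∼w , outside-sound G q

      -- A pendant vertex can afford one additional unit besides the one it sends. At least n - 5
      -- vertices are outside, so the units turn a bound of 3n - 1 on `∑ f` into 2n + 4 on the
      -- degree sum.
      f : Fin n → ℕ
      f u = d u + ⟦ outside G v u ⟧

      out-inner : ∀ u → (u ≡ v ⊎ v ∼ u) → outflow t u ≤ 0
      out-inner u inner = #-⊆list (t u) [] λ w p → let _ , u≢v , v≁u = t-sound p in
        contradiction inner [ u≢v , v≁u ]′

      f-inner : ∀ {u k} → ⟦ outside G v u ⟧ ≡ 0 → d u ≤ k → f u ≤ k
      f-inner {u} out≡0 d≤k = ≤-trans (≤-reflexive (trans (cong (d u +_) out≡0) (+-identityʳ _))) d≤k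

      exit-slack : ∀ {a x} → v ∼ a → a ∼ x → x ≢ v → ¬ v ∼ x → f a + outflow t a + 2 ≤ 3 + inflow t a
      exit-slack {a} v∼a a∼x x≢v v≁x = sink-slack 3 1 2
        (f-inner (outside-nbr G v∼a) (#-cover (adj G a) (λ w → t w a) (v ∷ []) cov))
        (out-inner a (inj₂ v∼a)) ≤-refl
        where
        cov : ∀ w → a ∼ w → t w a ≡ true ⊎ w ∈ v ∷ []
        cov w a∼w with mem? w (v ∷ [])
        ... | yes w∈ = inj₂ w∈
        ... | no w∉  = inj₁ (∧-intro (~-sym G a∼w)
          (outside-complete G (w∉ ∘ here) (λ v∼w → exit-nbrs v∼a a∼x x≢v v≁x v∼w a∼w)))

      -- The closed neighbourhood of `v` has at most five vertices, so `6 ≤ n` leaves one outside.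
      open Exit (2+deg≤n⇒exit G conn (≤-trans (+-monoʳ-≤ 2 d≤4) 6≤n)) renaming (a to b)

      -- The neighbour `b` of `v` that has an exit is adjacent to nothing in N(`v`); so `a` misses
      -- it, and its degree drops below that of `v`.
      inner-deg : ∀ {a} → v ∼ a → (∀ w → a ∼ w → w ≢ v → v ∼ w) → d a ≤ 3
      inner-deg {a} v∼a inner = s≤s⁻¹ (≤-trans (nested⇒deg< G v∼a v~a a≢b a≁b inner) d≤4)
        where
        a≢b : a ≢ b
        a≢b refl = v≁x (inner x a~x x≢v)
        a≁b : ¬ a ∼ b
        a≁b a∼b = exit-nbrs v~a a~x x≢v v≁x v∼a (~-sym G a∼b)

      balanced : ∀ u → u ∉ v ∷ [] → f u + outflow t u ≤ 3 + inflow t u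
      balanced u u∉ with near u
      ... | root = contradiction (here refl) u∉
      ... | far {a = a} v∼a a∼u u≢v v≁u = ≤-trans (m≤m+n _ 0) (source-slack (inflow t u) 2 1 0
        (+-mono-≤ (deg≤ G u (a ∷ []) (far-nbrs v∼a a∼u u≢v v≁u)) (⟦⟧≤1 (outside G v u)))
        (#-⊆list (t u) (a ∷ []) (λ w p → far-nbrs v∼a a∼u u≢v v≁u w (proj₁ (t-sound p)))) ≤-refl)
      ... | nbr v∼u with any? (λ x → ((G ~? u) x) ×-dec ¬? (x ≟ v) ×-dec ¬? ((G ~? v) x))
      ...   | yes (x , u∼x , x≢v , v≁x) = ≤-trans (m≤m+n _ 2) (exit-slack v∼u u∼x x≢v v≁x)
      ...   | no ∄ = ≤-trans (m≤m+n _ 0) (source-slack (inflow t u) 3 0 0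
        (f-inner (outside-nbr G v∼u) (inner-deg v∼u (λ w u∼w w≢v → decidable-stable ((G ~? v) w) (λ v≁w → ∄ (w , u∼w , w≢v , v≁w)))))
        (out-inner u (inj₂ v∼u)) ≤-refl)

    bound : ∑ d ≤ n * 2 + 4
    bound = +-cancelʳ-≤ (n + 2) _ _ (begin
      ∑ d + (n + 2)                     ≤⟨ +-monoʳ-≤ (∑ d) (+-monoˡ-≤ 2 (≤-trans (n≤#outside+deg+1 G v) (+-monoʳ-≤ O (+-monoˡ-≤ 1 d≤4)))) ⟩
      ∑ d + (O + 5 + 2)                 ≡⟨ arith₁ (∑ d) O ⟩
      ∑ d + O + 2 + 5                   ≡⟨ cong (λ s → s + 2 + 5) (sym (∑-distrib-+ d (⟦_⟧ ∘ outside G v))) ⟩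
      ∑ f + 2 + 5                       ≤⟨ +-monoˡ-≤ 5 (discharge t f 3 ((v , 1) ∷ []) ((b , 2) ∷ []) balanced
                                             (root-balance ∷ []) ([] ∷ []) (exit-slack v~a a~x x≢v v≁x ∷ [])) ⟩
      n * 3 + 1 + 5                     ≡⟨ arith₂ n ⟩
      n * 2 + 4 + (n + 2)               ∎)
      where
      open ≤-Reasoning
      O : ℕ
      O = # (outside G v)
      arith₁ : ∀ s o → s + (o + 5 + 2) ≡ s + o + 2 + 5
      arith₁ = solve-∀
      arith₂ : ∀ n → n * 3 + 1 + 5 ≡ n * 2 + 4 + (n + 2)
      arith₂ = solve-∀
      root-balance : f v + outflow t v ≤ 3 + inflow t v + 1
      root-balance = ≤-trans (+-mono-≤ (f-inner (outside-root G v) d≤4) (out-inner v (inj₁ refl)))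
        (≤-via (inflow t v) (arith₃ (inflow t v)))
        where
        arith₃ : ∀ i → 4 + 0 + i ≡ 3 + i + 1
        arith₃ = solve-∀

  module Subcubic (d≤3 : ∀ u → d u ≤ 3) {v : Fin n} (3≤d : 3 ≤ d v) where

    private
      -- Edges from N(`v`) to the outside are paid for twice at their end in N(`v`), so the outside
      -- costs nothing. What remains is 3 for `v` and 3 + 2 for each of its three neighbours, 18 in
      -- all.
      t : Fin n → Fin n → Bool
      t u w = adj G u w ∧ outside G v w

      t-sound : ∀ {u w} → t u w ≡ true → u ∼ w × (w ≢ v × ¬ v ∼ w)
      t-sound {u} {w} p with u∼w , q ← ∧-true {adj G u w} p = u∼w , outside-sound G q

      far-nbrs : ∀ {a u} → v ∼ a → a ∼ u → u ≢ v → ¬ v ∼ u → ∀ {w} → u ∼ w → v ∼ w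
      far-nbrs {a} {u} v∼a a∼u u≢v v≁u {w} u∼w = decidable-stable ((G ~? v) w) λ v≁w →
        case pickMany G 2 v (a ∷ []) 3≤d of λ
          { (e ∷ f ∷ [] , refl , (e≢f ∷ []) ∷ _ , v∼e ∷ v∼f ∷ [] , (e≢a ∷ []) ∷ (f≢a ∷ []) ∷ []) →
            no-path v∼a a∼u u∼w u≢v (λ { refl → v≁u (~-sym G u∼w) }) (≢-sym (∼≁⇒≢ v∼a v≁w)) v∼e v∼f e≢f
              (e≢a ∷ ∼≁⇒≢ v∼e v≁u ∷ ∼≁⇒≢ v∼e v≁w ∷ []) (f≢a ∷ ∼≁⇒≢ v∼f v≁u ∷ ∼≁⇒≢ v∼f v≁w ∷ []) }

      near : ∀ u → Near G v u
      near = all-near G conn v (λ v∼a a∼u u≢v v≁u u∼w → far-nbrs v∼a a∼u u≢v v≁u u∼w)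

      nbr-out : ∀ {u} → v ∼ u → outflow t u ≤ 2
      nbr-out {u} v∼u = +-cancelʳ-≤ 1 _ _ (≤-trans
        (balance (⟦_⟧ ∘ t u) (⟦_⟧ ∘ adj G u) [] ((v , 1) ∷ []) le [] ([] ∷ []) (root-out ∷ []))
        (≤-trans (≤-reflexive (+-identityʳ _)) (d≤3 u)))
        where
        le : ∀ w → w ∉ [] → ⟦ t u w ⟧ ≤ ⟦ adj G u w ⟧
        le w _ with t u w in p
        ... | false = z≤n
        ... | true  = ≤-reflexive (sym (cong ⟦_⟧ (proj₁ (t-sound p))))
        root-out : ⟦ t u v ⟧ + 1 ≤ ⟦ adj G u v ⟧
        root-out with t u v in p
        ... | true  = contradiction refl (proj₁ (proj₂ (t-sound {u} p)))
        ... | false = ≤-reflexive (sym (cong ⟦_⟧ (~-sym G v∼u)))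

    bound : ∑ d ≤ 18
    bound with pickMany G 3 v [] 3≤d
    ... | a ∷ b ∷ c ∷ [] , refl , uniq , v∼W@(v∼a ∷ v∼b ∷ v∼c ∷ []) , _ = begin
      ∑ d              ≤⟨ m≤m+n (∑ d) 0 ⟩
      ∑ d + 0          ≤⟨ discharge t d 0 ((v , 3) ∷ (a , 5) ∷ (b , 5) ∷ (c , 5) ∷ []) [] balanced
                            (root-balance ∷ nbr-balance v∼a ∷ nbr-balance v∼b ∷ nbr-balance v∼c ∷ []) [] [] ⟩
      n * 0 + 18       ≡⟨ cong (_+ 18) (*-zeroʳ n) ⟩
      18               ∎
      where
      open ≤-Reasoning
      root-balance : d v + outflow t v ≤ inflow t v + 3
      root-balance = ≤-trans (+-mono-≤ (d≤3 v) (#-⊆list (t v) [] λ w p → let v∼w , _ , v≁w = t-sound p in contradiction v∼w v≁w))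
                             (m≤n+m 3 _)
      nbr-balance : ∀ {u} → v ∼ u → d u + outflow t u ≤ inflow t u + 5
      nbr-balance v∼u = ≤-trans (+-mono-≤ (d≤3 _) (nbr-out v∼u)) (m≤n+m 5 _)
      balanced : ∀ u → u ∉ v ∷ a ∷ b ∷ c ∷ [] → d u + outflow t u ≤ inflow t u
      balanced u u∉ with near u
      ... | root = contradiction (here refl) u∉
      ... | nbr v∼u = contradiction
        (list⊆-# (adj G v) (u ∷ a ∷ b ∷ c ∷ [])
          (((u∉ ∘ there ∘ here) ∷ (u∉ ∘ there ∘ there ∘ here) ∷ (u∉ ∘ there ∘ there ∘ there ∘ here) ∷ []) ∷ uniq)
          (v∼u ∷ v∼W)) (<⇒≱ (s≤s (d≤3 v)))
      ... | far v∼a a∼u u≢v v≁u = ≤-trans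
        (+-mono-≤ (#-cover (adj G u) (λ w → t w u) [] (λ w u∼w → inj₁ (∧-intro (~-sym G u∼w) (outside-complete G u≢v v≁u))))
                  (#-⊆list (t u) [] λ w p → let u∼w , _ , v≁w = t-sound p in contradiction (far-nbrs v∼a a∼u u≢v v≁u u∼w) v≁w))
        (≤-reflexive (trans (+-identityʳ _) (+-identityʳ _)))

  -- The alternatives belong to maximum degree at least 5, to 4 or at most 2, and to 3.
  S₃₁₁-free⇒∑deg≤ : 6 ≤ n → ∑ (deg G) + 3 ≤ n * 3 ⊎ ∑ (deg G) ≤ n * 2 + 4 ⊎ ∑ (deg G) ≤ 18
  S₃₁₁-free⇒∑deg≤ 6≤n with any? (λ v → 5 ≤? d v)
  ... | yes (v , 5≤d) = inj₁ (HighDegree.bound 5≤d)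
  ... | no ∄₅ with any? (λ v → 4 ≤? d v)
  ...   | yes (v , 4≤d) = inj₂ (inj₁ (DegreeFour.bound 6≤n 4≤d (≮⇒≥ (λ 5≤d → ∄₅ (v , 5≤d)))))
  ...   | no ∄₄ with any? (λ v → 3 ≤? d v)
  ...     | yes (v , 3≤d) = inj₂ (inj₂ (Subcubic.bound (λ u → ≮⇒≥ (λ 4≤d → ∄₄ (u , 4≤d))) 3≤d))
  ...     | no ∄₃ = inj₂ (inj₁ (≤-trans (m≤m+n _ 0) (≤-trans
    (bounded d 2 [] [] (λ u _ → ≮⇒≥ (λ 3≤d → ∄₃ (u , 3≤d))) [] [] []) (+-monoʳ-≤ (n * 2) z≤n))))

-- Upper bound for D_{2,2}

module _ (G : Graph n) (conn : Connected G) (6≤n : 6 ≤ n) (free : ¬ Contains G (DoubleStar 2 2)) where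

  private
    infix 4 _∼_
    _∼_ = _~_ G
    d = deg G

    ∼≁⇒≢ : ∀ {v u w} → v ∼ u → ¬ v ∼ w → u ≢ w
    ∼≁⇒≢ v∼u v≁w refl = v≁w v∼u

    -- A third neighbour `y` of `w` would complete a double star with centres `u` and `w`: four
    -- neighbours leave `u` two outside `w` and `y`, and `x` is not among them.
    exit-deg : ∀ {u w x} → 4 ≤ d u → u ∼ w → w ∼ x → x ≢ u → ¬ u ∼ x → d w ≤ 2
    exit-deg {u} {w} {x} 4≤d u∼w w∼x x≢u u≁x = ≮⇒≥ λ 3≤d →
      let y , w∼y , y∉ = pick G w (u ∷ x ∷ []) 3≤d in
      case pickMany G 2 u (w ∷ y ∷ []) 4≤d of λ
        { (a ∷ b ∷ [] , refl , (a≢b ∷ []) ∷ _ , u∼a ∷ u∼b ∷ [] , (a≢w ∷ a≢y ∷ []) ∷ (b≢w ∷ b≢y ∷ []) ∷ []) →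
          free (D₂₂-embed G
            ((~⇒≢ G u∼w ∷ ~⇒≢ G u∼a ∷ ~⇒≢ G u∼b ∷ ≢-sym x≢u ∷ (λ eq → y∉ (here (sym eq))) ∷ [])
             ∷ (≢-sym a≢w ∷ ≢-sym b≢w ∷ ~⇒≢ G w∼x ∷ ~⇒≢ G w∼y ∷ [])
             ∷ (a≢b ∷ ∼≁⇒≢ u∼a u≁x ∷ a≢y ∷ []) ∷ (∼≁⇒≢ u∼b u≁x ∷ b≢y ∷ [])
             ∷ ((λ eq → y∉ (there (here (sym eq)))) ∷ []) ∷ [] ∷ [])
            u∼w u∼a u∼b w∼x w∼y) }

    closed-nbr : ∀ {u p q} → 4 ≤ d u → u ∼ p → 3 ≤ d p → p ∼ q → q ≢ u → u ∼ q
    closed-nbr {u} {p} {q} 4≤d u∼p 3≤dp p∼q q≢u = decidable-stable ((G ~? u) q)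
      (λ u≁q → <⇒≱ 3≤dp (exit-deg 4≤d u∼p p∼q q≢u u≁q))

    nbr-deg≤2 : ∀ {u w} → 5 ≤ d u → u ∼ w → d w ≤ 2
    nbr-deg≤2 {u} {w} 5≤d u∼w = ≮⇒≥ λ 3≤d →
      case pickMany G 2 w (u ∷ []) 3≤d of λ
        { (x ∷ y ∷ [] , refl , (x≢y ∷ []) ∷ _ , w∼x ∷ w∼y ∷ [] , (x≢u ∷ []) ∷ (y≢u ∷ []) ∷ []) →
      case pickMany G 2 u (w ∷ x ∷ y ∷ []) 5≤d of λ
        { (a ∷ b ∷ [] , refl , (a≢b ∷ []) ∷ _ , u∼a ∷ u∼b ∷ [] , (a≢w ∷ a≢x ∷ a≢y ∷ []) ∷ (b≢w ∷ b≢x ∷ b≢y ∷ []) ∷ []) →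
          free (D₂₂-embed G
            ((~⇒≢ G u∼w ∷ ~⇒≢ G u∼a ∷ ~⇒≢ G u∼b ∷ ≢-sym x≢u ∷ ≢-sym y≢u ∷ [])
             ∷ (≢-sym a≢w ∷ ≢-sym b≢w ∷ ~⇒≢ G w∼x ∷ ~⇒≢ G w∼y ∷ [])
             ∷ (a≢b ∷ a≢x ∷ a≢y ∷ []) ∷ (b≢x ∷ b≢y ∷ []) ∷ (x≢y ∷ []) ∷ [] ∷ [])
            u∼w u∼a u∼b w∼x w∼y) } }

    degree-four-exit : ∀ {u} → d u ≤ 4 → Exit G u
    degree-four-exit d≤4 = 2+deg≤n⇒exit G conn (≤-trans (+-monoʳ-≤ 2 d≤4) 6≤n)

    -- The critical case is degree 4 at `u`. If `p` had degree at least 4, its neighbours other than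
    -- `u` would lie in N(`u`) by `closed-nbr`, but not include `w`, whose two places are taken by
    -- `u` and `x`; so `p` would have smaller degree than `u`.
    nbr-deg≤3 : ∀ {u p} → 4 ≤ d u → u ∼ p → d p ≤ 3
    nbr-deg≤3 {u} {p} 4≤d u∼p with 5 ≤? d u
    ... | yes 5≤d = ≤-trans (nbr-deg≤2 5≤d u∼p) (n≤1+n 2)
    ... | no 5≰d with degree-four-exit (≮⇒≥ 5≰d)
    ...   | exit {w} {x} u∼w w∼x x≢u u≁x = ≮⇒≥ λ 4≤dp →
      let p≢w : p ≢ w
          p≢w = λ { refl → <⇒≱ (<⇒≤ 4≤dp) dw≤2 }
      in <⇒≱ 4≤dp (s≤s⁻¹ (≤-trans
        (nested⇒deg< G u∼p u∼w p≢w
          (λ p∼w → <⇒≱ (list⊆-# (adj G w) (u ∷ x ∷ p ∷ [])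
                         ((≢-sym x≢u ∷ ~⇒≢ G u∼p ∷ []) ∷ (≢-sym (∼≁⇒≢ u∼p u≁x) ∷ []) ∷ [] ∷ [])
                         (~-sym G u∼w ∷ w∼x ∷ ~-sym G p∼w ∷ [])) dw≤2)
          (λ q p∼q q≢u → closed-nbr 4≤d u∼p (<⇒≤ 4≤dp) p∼q q≢u))
        (≮⇒≥ 5≰d)))
      where
      dw≤2 : d w ≤ 2
      dw≤2 = exit-deg 4≤d u∼w w∼x x≢u u≁x

    open Transfer G 3 4

    hub-slack : ∀ {v} → 4 ≤ d v → d v + out v + 4 ≤ 4 + in′ v
    hub-slack {v} 4≤d = sink-slack 4 0 4 (deg≤in′+length v [] 4≤d (λ y v∼y _ → nbr-deg≤3 4≤d v∼y)) (out≤0 4≤d) ≤-refl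

    balanced : ∀ u → d u + out u ≤ 4 + in′ u
    balanced u with 4 ≤? d u | 3 ≤? d u
    ... | yes 4≤d | _ = ≤-trans (m≤m+n _ 4) (hub-slack 4≤d)
    ... | no _    | no 3≰d  = ≤-trans (m≤m+n _ 0)
        (source-slack (in′ u) 2 2 0 (≮⇒≥ 3≰d) (≤-trans (out≤deg u) (≮⇒≥ 3≰d)) ≤-refl)
    ... | no 4≰d  | yes 3≤d with any? (λ v → ((G ~? u) v) ×-dec (4 ≤? d v))
    ...   | no ∄ = ≤-trans (m≤m+n _ 0) (source-slack (in′ u) 3 0 0 (≮⇒≥ 4≰d)
      (out≤length u [] (λ w u∼w _ 4≤dw → contradiction (w , u∼w , 4≤dw) ∄)) (n≤1+n 3))
    ...   | yes (v , u∼v , 4≤dv) = ≤-trans (m≤m+n _ 0) (source-slack (in′ u) 3 1 0 (≮⇒≥ 4≰d)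
      (out≤length u (v ∷ []) only-v) ≤-refl)
      where
      -- The other neighbours of `u` are neighbours of `v` too, so their degree is at most 3.
      only-v : ∀ w → u ∼ w → d u ≤ 3 → 4 ≤ d w → w ∈ v ∷ []
      only-v w u∼w _ 4≤dw = decidable-stable (mem? w (v ∷ [])) λ w∉ →
        <⇒≱ 4≤dw (nbr-deg≤3 4≤dv (closed-nbr 4≤dv (~-sym G u∼v) 3≤d u∼w (w∉ ∘ here)))

    by-discharge : (L : List (Fin n × ℕ)) → 7 ≤ sum (map proj₂ L) → Unique (map proj₁ L) →
      All (λ p → d (proj₁ p) + out (proj₁ p) + proj₂ p ≤ 4 + in′ (proj₁ p)) L → ∑ d + 7 ≤ n * 4
    by-discharge L total uniq slack = begin
      ∑ d + 7                    ≤⟨ +-monoʳ-≤ (∑ d) total ⟩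
      ∑ d + sum (map proj₂ L)    ≤⟨ discharge transfer d 4 [] L (λ u _ → balanced u) [] uniq slack ⟩
      n * 4 + 0                  ≡⟨ +-identityʳ _ ⟩
      n * 4                      ∎
      where open ≤-Reasoning

    large : 7 ≤ n → ∑ d ≤ n * 3 → ∑ d + 7 ≤ n * 4
    large 7≤n le = ≤-trans (+-mono-≤ le 7≤n) (≤-reflexive (arith n))
      where
      arith : ∀ n → n * 3 + n ≡ n * 4
      arith = solve-∀

    six : n ≡ 6 → ∑ d ≤ 17 → ∑ d + 7 ≤ n * 4
    six n≡6 le = ≤-trans (+-monoˡ-≤ 7 le) (≤-reflexive (cong (_* 4) (sym n≡6)))

    all≤n : (L : List (Fin n)) → Unique L → length L ≤ n
    all≤n L uniq = ≤-trans (list⊆-# (λ _ → true) L uniq (All.universal (λ _ → refl) L))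
      (≤-reflexive (trans (∑-const n 1) (*-identityʳ n)))

    module OneDegreeFour {v : Fin n} (4≤d : 4 ≤ d v) (d≤4 : d v ≤ 4) (rest : ∀ u → u ≢ v → d u ≤ 3) where

      open Exit (degree-four-exit d≤4) renaming (a to w; v~a to v∼w; a~x to w∼x)

      dw≤2 : d w ≤ 2
      dw≤2 = exit-deg 4≤d v∼w w∼x x≢v v≁x

      with-slack : (L : List (Fin n × ℕ)) → Unique (map proj₁ L) →
        All (λ p → d (proj₁ p) + proj₂ p ≤ 3) L → ∑ d + sum (map proj₂ L) ≤ n * 3 + 1
      with-slack L = bounded d 3 ((v , 1) ∷ []) L (λ u u∉ → rest u (u∉ ∘ here)) (d≤4 ∷ [])

      -- The degrees alone give 3n + 1. For n at least 7 the degree 2 of `w` saves enough; for n = 6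
      -- the target is 17, and a second unit comes from `x` itself or from another neighbour `y` of
      -- `x`, which has an exit as well.
      bound : 7 ≤ n ⊎ n ≡ 6 → ∑ d + 7 ≤ n * 4
      bound (inj₁ 7≤n) = large 7≤n (+-cancelʳ-≤ 1 _ _ (with-slack ((w , 1) ∷ []) ([] ∷ []) (+-monoˡ-≤ 1 dw≤2 ∷ [])))
      bound (inj₂ n≡6) with 2 ≤? d x
      ... | no 2≰d = six n≡6 (+-cancelʳ-≤ 3 _ _ (≤-trans
        (with-slack ((w , 1) ∷ (x , 2) ∷ []) ((~⇒≢ G w∼x ∷ []) ∷ [] ∷ []) (+-monoˡ-≤ 1 dw≤2 ∷ +-monoˡ-≤ 2 (≮⇒≥ 2≰d) ∷ []))
        (≤-trans (≤-reflexive (cong (λ k → k * 3 + 1) n≡6)) (n≤1+n 19))))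
      ... | yes 2≤d with pick G x (w ∷ []) 2≤d
      ...   | y , x∼y , y∉ = six n≡6 (+-cancelʳ-≤ 2 _ _ (≤-trans
        (with-slack ((w , 1) ∷ (y , 1) ∷ []) (((λ w≡y → y∉ (here (sym w≡y))) ∷ []) ∷ [] ∷ [])
          (+-monoˡ-≤ 1 dw≤2 ∷ +-monoˡ-≤ 1 (exit-deg 4≤d v∼y (~-sym G x∼y) x≢v v≁x) ∷ []))
        (≤-reflexive (cong (λ k → k * 3 + 1) n≡6))))
        where
        y≢v : y ≢ v
        y≢v refl = v≁x (~-sym G x∼y)
        -- Six vertices are exhausted by `v`, its four neighbours and `x`.
        v∼y : v ∼ y
        v∼y = decidable-stable ((G ~? v) y) λ v≁y → case pickMany G 4 v [] 4≤d of λ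
          { (p ∷ q ∷ r ∷ s ∷ [] , refl , uniq , v∼W , _) → <⇒≱
            (all≤n (v ∷ x ∷ y ∷ p ∷ q ∷ r ∷ s ∷ [])
              ((≢-sym x≢v ∷ ≢-sym y≢v ∷ All.map (~⇒≢ G) v∼W)
               ∷ (~⇒≢ G x∼y ∷ All.map (λ v∼z → ≢-sym (∼≁⇒≢ v∼z v≁x)) v∼W)
               ∷ All.map (λ v∼z → ≢-sym (∼≁⇒≢ v∼z v≁y)) v∼W ∷ uniq)) (≤-reflexive n≡6) }

    -- In a cubic graph on v, N(v) = {a, b, c} and two further vertices x, y, both x and y have
    -- two neighbours in N(v), hence a common one, which contradicts freeness.
    not-cubic : n ≡ 6 → (∀ u → d u ≤ 3) → ¬ (∀ u → 3 ≤ d u)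
    not-cubic n≡6 d≤3 3≤d = case pickMany G 3 v [] (3≤d v) of λ
      { (a ∷ b ∷ c ∷ [] , refl , uniq , v∼W , _) → contra (a ∷ b ∷ c ∷ []) refl uniq v∼W }
      where
      v : Fin n
      v = fromℕ< (≤-trans (s≤s z≤n) 6≤n)
      open Exit (2+deg≤n⇒exit G conn {v} (≤-trans (+-monoʳ-≤ 2 (d≤3 v)) (<⇒≤ 6≤n))) using (x; x≢v; v≁x)
      one-exit : ∀ {a x y} → v ∼ a → a ∼ x → a ∼ y → x ≢ v → y ≢ v → ¬ v ∼ x → ¬ v ∼ y → ¬ x ≢ y
      one-exit {a} v∼a a∼x a∼y x≢v y≢v v≁x v≁y x≢y = case pickMany G 2 v (a ∷ []) (3≤d v) of λ
        { (b ∷ c ∷ [] , refl , (b≢c ∷ []) ∷ _ , v∼b ∷ v∼c ∷ [] , (b≢a ∷ []) ∷ (c≢a ∷ []) ∷ []) →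
          free (D₂₂-embed G
            ((~⇒≢ G v∼a ∷ ~⇒≢ G v∼b ∷ ~⇒≢ G v∼c ∷ ≢-sym x≢v ∷ ≢-sym y≢v ∷ [])
             ∷ (≢-sym b≢a ∷ ≢-sym c≢a ∷ ~⇒≢ G a∼x ∷ ~⇒≢ G a∼y ∷ [])
             ∷ (b≢c ∷ ∼≁⇒≢ v∼b v≁x ∷ ∼≁⇒≢ v∼b v≁y ∷ []) ∷ (∼≁⇒≢ v∼c v≁x ∷ ∼≁⇒≢ v∼c v≁y ∷ []) ∷ (x≢y ∷ []) ∷ [] ∷ [])
            v∼a v∼b v∼c a∼x a∼y) }
      contra : ∀ W → length W ≡ 3 → Unique W → All (v ∼_) W → ⊥
      contra W |W| uniq v∼W with any? (λ y → ¬? (mem? y (v ∷ x ∷ W)))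
      ... | no ∄ = <⇒≱ 6≤n (≤-trans (≤-reflexive (sym (trans (∑-const n 1) (*-identityʳ n)))) (≤-trans
        (#-⊆list {n} (λ _ → true) (v ∷ x ∷ W) (λ u _ → decidable-stable (mem? u (v ∷ x ∷ W)) (λ u∉ → ∄ (u , u∉))))
        (≤-reflexive (cong (2 +_) |W|))))
      ... | yes (y , y∉) =
        case pickMany G 2 x (y ∷ []) (3≤d x) of λ
          { (p ∷ q ∷ [] , refl , (p≢q ∷ []) ∷ _ , x∼p ∷ x∼q ∷ [] , (p≢y ∷ []) ∷ (q≢y ∷ []) ∷ []) →
        case pickMany G 2 y (x ∷ []) (3≤d y) of λ
          { (r ∷ s ∷ [] , refl , (r≢s ∷ []) ∷ _ , y∼r ∷ y∼s ∷ [] , (r≢x ∷ []) ∷ (s≢x ∷ []) ∷ []) →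
        common x∼p x∼q y∼r y∼s p≢q r≢s
          (complete p (λ { refl → v≁x (~-sym G x∼p) }) (≢-sym (~⇒≢ G x∼p)) p≢y)
          (complete q (λ { refl → v≁x (~-sym G x∼q) }) (≢-sym (~⇒≢ G x∼q)) q≢y)
          (complete r (λ { refl → v≁y (~-sym G y∼r) }) r≢x (≢-sym (~⇒≢ G y∼r)))
          (complete s (λ { refl → v≁y (~-sym G y∼s) }) s≢x (≢-sym (~⇒≢ G y∼s))) } }
        where
        y≢v : y ≢ v
        y≢v = y∉ ∘ here
        y≢x : y ≢ x
        y≢x = y∉ ∘ there ∘ here
        y≢W : All (y ≢_) W
        y≢W = All.tabulate (λ {z} z∈ y≡z → y∉ (there (there (subst (_∈ W) (sym y≡z) z∈))))
        v≁y : ¬ v ∼ y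
        v≁y v∼y = <⇒≱ (≤-trans (≤-reflexive (cong suc (sym |W|))) (list⊆-# (adj G v) (y ∷ W) (y≢W ∷ uniq) (v∼y ∷ v∼W))) (d≤3 v)
        complete : ∀ p → p ≢ v → p ≢ x → p ≢ y → v ∼ p
        complete p p≢v p≢x p≢y = decidable-stable ((G ~? v) p) λ v≁p →
          <⇒≱ (≤-trans (≤-reflexive (cong (4 +_) (sym |W|)))
            (all≤n (v ∷ x ∷ y ∷ p ∷ W)
              ((≢-sym x≢v ∷ ≢-sym y≢v ∷ ≢-sym p≢v ∷ All.map (~⇒≢ G) v∼W)
               ∷ (≢-sym y≢x ∷ ≢-sym p≢x ∷ All.map (λ v∼z → ≢-sym (∼≁⇒≢ v∼z v≁x)) v∼W)
               ∷ (≢-sym p≢y ∷ y≢W)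
               ∷ All.map (λ v∼z → ≢-sym (∼≁⇒≢ v∼z v≁p)) v∼W ∷ uniq))) (≤-reflexive n≡6)
        clash : ∀ {z z′} → v ∼ z → x ∼ z → y ∼ z′ → z ≢ z′
        clash v∼z x∼z y∼z refl = one-exit v∼z (~-sym G x∼z) (~-sym G y∼z) x≢v y≢v v≁x v≁y (≢-sym y≢x)
        common : ∀ {p q r s} → x ∼ p → x ∼ q → y ∼ r → y ∼ s → p ≢ q → r ≢ s →
                 v ∼ p → v ∼ q → v ∼ r → v ∼ s → ⊥
        common {p} {q} {r} {s} x∼p x∼q y∼r y∼s p≢q r≢s v∼p v∼q v∼r v∼s =
          <⇒≱ (list⊆-# (adj G v) (p ∷ q ∷ r ∷ s ∷ [])
            ((p≢q ∷ clash v∼p x∼p y∼r ∷ clash v∼p x∼p y∼s ∷ [])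
             ∷ (clash v∼q x∼q y∼r ∷ clash v∼q x∼q y∼s ∷ []) ∷ (r≢s ∷ []) ∷ [] ∷ [])
            (v∼p ∷ v∼q ∷ v∼r ∷ v∼s ∷ [])) (d≤3 v)

    7≤n⊎n≡6 : 7 ≤ n ⊎ n ≡ 6
    7≤n⊎n≡6 with m≤n⇒m<n∨m≡n 6≤n
    ... | inj₁ 7≤n = inj₁ 7≤n
    ... | inj₂ 6≡n = inj₂ (sym 6≡n)

    hubless-bound : (∀ u → d u ≤ 3) → 7 ≤ n ⊎ n ≡ 6 → ∑ d + 7 ≤ n * 4
    hubless-bound d≤3 (inj₁ 7≤n) = large 7≤n (≤-trans (m≤m+n _ 0)
      (≤-trans (bounded d 3 [] [] (λ u _ → d≤3 u) [] [] []) (≤-reflexive (+-identityʳ _))))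
    hubless-bound d≤3 (inj₂ n≡6) with any? (λ u → d u ≤? 2)
    ... | no ∄ = ⊥-elim (not-cubic n≡6 d≤3 (λ u → ≰⇒> (λ d≤2 → ∄ (u , d≤2))))
    ... | yes (u , d≤2) = six n≡6 (+-cancelʳ-≤ 1 _ _ (≤-trans
      (bounded d 3 [] ((u , 1) ∷ []) (λ u _ → d≤3 u) [] ([] ∷ []) (+-monoˡ-≤ 1 d≤2 ∷ []))
      (≤-reflexive (cong (λ k → k * 3 + 0) n≡6))))

  D₂₂-free⇒∑deg≤ : ∑ (deg G) + 7 ≤ n * 4
  D₂₂-free⇒∑deg≤ with any? (λ v → 4 ≤? d v)
  ... | no ∄ = hubless-bound (λ u → ≮⇒≥ (λ 4≤d → ∄ (u , 4≤d))) 7≤n⊎n≡6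
  ... | yes (v , 4≤d) with any? (λ u → ¬? (u ≟ v) ×-dec (4 ≤? d u))
  ...   | yes (u , u≢v , 4≤du) = by-discharge ((v , 4) ∷ (u , 4) ∷ []) (n≤1+n 7) ((≢-sym u≢v ∷ []) ∷ [] ∷ [])
                                   (hub-slack 4≤d ∷ hub-slack 4≤du ∷ [])
  ...   | no ∄ with 5 ≤? d v
  ...     | no 5≰d = OneDegreeFour.bound 4≤d (≮⇒≥ 5≰d) (λ u u≢v → ≮⇒≥ (λ 4≤du → ∄ (u , u≢v , 4≤du))) 7≤n⊎n≡6
  ...     | yes 5≤d with pickMany G 4 v [] 4≤d
  ...       | x ∷ y ∷ z ∷ w ∷ [] , refl , uniq , v∼x ∷ v∼y ∷ v∼z ∷ v∼w ∷ [] , _ =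
    by-discharge ((v , 4) ∷ (x , 1) ∷ (y , 1) ∷ (z , 1) ∷ (w , 1) ∷ []) (n≤1+n 7)
      ((~⇒≢ G v∼x ∷ ~⇒≢ G v∼y ∷ ~⇒≢ G v∼z ∷ ~⇒≢ G v∼w ∷ []) ∷ uniq)
      (hub-slack 4≤d ∷ nbr-slack v∼x ∷ nbr-slack v∼y ∷ nbr-slack v∼z ∷ nbr-slack v∼w ∷ [])
    where
    -- `v` is the only vertex of degree at least 4, so a neighbour of degree at most 2 sends one
    -- unit and keeps one.
    nbr-slack : ∀ {y} → v ∼ y → d y + out y + 1 ≤ 4 + in′ y
    nbr-slack {y} v∼y = source-slack (in′ y) 2 1 1 (nbr-deg≤2 5≤d v∼y)
      (out≤length y (v ∷ []) (λ w _ _ 4≤dw → decidable-stable (mem? w (v ∷ [])) (λ w∉ → ∄ (w , w∉ ∘ here , 4≤dw)))) ≤-refl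

-- Extremal graphs

half-unique : ∀ e {m} → e + e ≤ m → m ≤ suc (e + e) → e ≡ m / 2
half-unique e {m} lo hi = ≤-antisym (e+e≤m⇒e≤m/2 e lo) (≮⇒≥ λ e<m/2 → <⇒≱ (s≤s hi) (begin
  2 + (e + e)   ≡⟨ arith e ⟩
  suc e * 2     ≤⟨ *-monoˡ-≤ 2 e<m/2 ⟩
  m / 2 * 2     ≤⟨ m/n*n≤m m 2 ⟩
  m             ∎))
  where
  open ≤-Reasoning
  arith : ∀ e → 2 + (e + e) ≡ suc e * 2
  arith = solve-∀

module _ {G : Graph n} where

  reach-trans : ∀ {u v w} → Reach G u v → Reach G v w → Reach G u w
  reach-trans here       r = r
  reach-trans (step p q) r = step p (reach-trans q r)

  reach-sym : ∀ {u v} → Reach G u v → Reach G v u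
  reach-sym here       = here
  reach-sym (step p r) = reach-trans (reach-sym r) (step (~-sym G p) here)

  connected-via : ∀ r → (∀ u → Reach G u r) → Connected G
  connected-via r to-r u v = reach-trans (to-r u) (reach-sym (to-r v))

consecutive⇒connected : (G : Graph n) → (∀ {i j} → toℕ j ≡ suc (toℕ i) → adj G j i ≡ true) → Connected G
consecutive⇒connected {zero}  G next ()
consecutive⇒connected {suc n} G next = connected-via zero
  (<-weakInduction (λ u → Reach G u zero) here (λ i r → step (next (cong suc (sym (toℕ-inject₁ i)))) r))

-- Cones, K_{1,1,m} and K_{2,m}

extend : (Fin n → Bool) → Graph n → Graph (suc n)
extend S G .adj zero    zero    = false
extend S G .adj zero    (suc j) = S j
extend S G .adj (suc i) zero    = S i
extend S G .adj (suc i) (suc j) = adj G i j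
extend S G .adj-sym zero    zero    = refl
extend S G .adj-sym zero    (suc j) = refl
extend S G .adj-sym (suc i) zero    = refl
extend S G .adj-sym (suc i) (suc j) = adj-sym G i j
extend S G .adj-irrefl zero    = refl
extend S G .adj-irrefl (suc i) = adj-irrefl G i

-- The new vertex is the smallest, so its edges form the first row of the count and the other rows
-- reduce to those of `G`.
edgeCount-extend : (S : Fin n → Bool) (G : Graph n) → edgeCount (extend S G) ≡ # S + edgeCount G
edgeCount-extend S G = trans (edgeCount≡∑ (extend S G)) (cong (# S +_) (sym (edgeCount≡∑ G)))

empty : ∀ n → Graph n
empty n .adj _ _ = false
empty n .adj-sym _ _ = refl
empty n .adj-irrefl _ = refl

edgeCount-empty : ∀ n → edgeCount (empty n) ≡ 0
edgeCount-empty n = trans (edgeCount≡∑ (empty n))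
  (∑-zero {n} λ i → ∑-zero {n} λ j → cong ⟦_⟧ (∧-zeroʳ (toℕ i <ᵇ toℕ j)))

everything nothing : Fin n → Bool
everything _ = true
nothing    _ = false

#-everything : ∀ n → # (everything {n}) ≡ n
#-everything n = trans (∑-const n 1) (*-identityʳ n)

#-nothing : ∀ n → # (nothing {n}) ≡ 0
#-nothing n = ∑-zero {n} λ _ → refl

isZero isSuc : Fin n → Bool
isZero zero    = true
isZero (suc _) = false
isSuc zero    = false
isSuc (suc _) = true

cone : Graph n → Graph (suc n)
cone = extend everything

cone-connected : (G : Graph n) → Connected (cone G)
cone-connected G = connected-via zero λ { zero → here ; (suc u) → step refl here }

edgeCount-cone : (G : Graph n) → edgeCount (cone G) ≡ n + edgeCount G
edgeCount-cone {n} G = trans (edgeCount-extend everything G) (cong (_+ edgeCount G) (#-everything n))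

not-three-of-two : ∀ {A : Set} {p q a b c : A} → a ≢ b → a ≢ c → b ≢ c →
  a ≡ p ⊎ a ≡ q → b ≡ p ⊎ b ≡ q → c ≡ p ⊎ c ≡ q → ⊥
not-three-of-two a≢b a≢c b≢c (inj₁ refl) (inj₁ refl) _           = a≢b refl
not-three-of-two a≢b a≢c b≢c (inj₂ refl) (inj₂ refl) _           = a≢b refl
not-three-of-two a≢b a≢c b≢c (inj₁ refl) (inj₂ refl) (inj₁ refl) = a≢c refl
not-three-of-two a≢b a≢c b≢c (inj₁ refl) (inj₂ refl) (inj₂ refl) = b≢c refl
not-three-of-two a≢b a≢c b≢c (inj₂ refl) (inj₁ refl) (inj₁ refl) = b≢c refl
not-three-of-two a≢b a≢c b≢c (inj₂ refl) (inj₁ refl) (inj₂ refl) = a≢c refl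

module _ (m : ℕ) where

  -- `isSuc` omits the apex of the inner cone, so that the two apices of K_{2,m} are not joined.
  K₁,₁,ₘ K₂,ₘ : Graph (2 + m)
  K₁,₁,ₘ = cone (cone (empty m))
  K₂,ₘ = extend isSuc (cone (empty m))

  private
    Apex : Fin (2 + m) → Set
    Apex u = u ≡ zero ⊎ u ≡ suc zero

  -- The spider has a perfect matching of three edges, while two apices cover all edges of
  -- K_{1,1,m}.
  K₁,₁,ₘ-S₂₂₁-free : ¬ Contains K₁,₁,ₘ (Spider (2 ∷ 2 ∷ 1 ∷ []))
  K₁,₁,ₘ-S₂₂₁-free (φ , inj , hom) = disjoint-edges (cover (hom 1F 2F refl)) (cover (hom 3F 4F refl)) (cover (hom 0F 5F refl))
    where
    cover : ∀ {u w} → adj K₁,₁,ₘ u w ≡ true → Apex u ⊎ Apex w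
    cover {zero}                       _ = inj₁ (inj₁ refl)
    cover {suc zero}                   _ = inj₁ (inj₂ refl)
    cover {suc (suc _)} {zero}         _ = inj₂ (inj₁ refl)
    cover {suc (suc _)} {suc zero}     _ = inj₂ (inj₂ refl)
    φ≢ : ∀ {i j} → i ≢ j → φ i ≢ φ j
    φ≢ i≢j = i≢j ∘ inj
    disjoint-edges : Apex (φ 1F) ⊎ Apex (φ 2F) → Apex (φ 3F) ⊎ Apex (φ 4F) → Apex (φ 0F) ⊎ Apex (φ 5F) → ⊥
    disjoint-edges (inj₁ p) (inj₁ q) (inj₁ r) = not-three-of-two (φ≢ λ ()) (φ≢ λ ()) (φ≢ λ ()) p q r
    disjoint-edges (inj₁ p) (inj₁ q) (inj₂ r) = not-three-of-two (φ≢ λ ()) (φ≢ λ ()) (φ≢ λ ()) p q r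
    disjoint-edges (inj₁ p) (inj₂ q) (inj₁ r) = not-three-of-two (φ≢ λ ()) (φ≢ λ ()) (φ≢ λ ()) p q r
    disjoint-edges (inj₁ p) (inj₂ q) (inj₂ r) = not-three-of-two (φ≢ λ ()) (φ≢ λ ()) (φ≢ λ ()) p q r
    disjoint-edges (inj₂ p) (inj₁ q) (inj₁ r) = not-three-of-two (φ≢ λ ()) (φ≢ λ ()) (φ≢ λ ()) p q r
    disjoint-edges (inj₂ p) (inj₁ q) (inj₂ r) = not-three-of-two (φ≢ λ ()) (φ≢ λ ()) (φ≢ λ ()) p q r
    disjoint-edges (inj₂ p) (inj₂ q) (inj₁ r) = not-three-of-two (φ≢ λ ()) (φ≢ λ ()) (φ≢ λ ()) p q r
    disjoint-edges (inj₂ p) (inj₂ q) (inj₂ r) = not-three-of-two (φ≢ λ ()) (φ≢ λ ()) (φ≢ λ ()) p q r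

  edgeCount-K₁,₁,ₘ : edgeCount K₁,₁,ₘ ≡ suc m + (m + 0)
  edgeCount-K₁,₁,ₘ = trans (edgeCount-cone (cone (empty m)))
    (cong (suc m +_) (trans (edgeCount-cone (empty m)) (cong (m +_) (edgeCount-empty m))))

  -- Both colour classes of D_{2,2} have three vertices, and one of them would have to fit into the
  -- two apices.
  K₂,ₘ-D₂₂-free : ¬ Contains K₂,ₘ (DoubleStar 2 2)
  K₂,ₘ-D₂₂-free (φ , inj , hom) = bipartite-clash
    where
    apex : Fin (2 + m) → Bool
    apex zero          = true
    apex (suc zero)    = true
    apex (suc (suc _)) = false
    apex-sound : ∀ {u} → apex u ≡ true → Apex u
    apex-sound {zero}     _ = inj₁ refl
    apex-sound {suc zero} _ = inj₂ refl
    opposite : ∀ {u w} → adj K₂,ₘ u w ≡ true → apex w ≡ not (apex u)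
    opposite {zero}        {suc (suc _)} _ = refl
    opposite {suc zero}    {suc (suc _)} _ = refl
    opposite {suc (suc _)} {zero}        _ = refl
    opposite {suc (suc _)} {suc zero}    _ = refl
    φ≢ : ∀ {i j} → i ≢ j → φ i ≢ φ j
    φ≢ i≢j = i≢j ∘ inj
    bipartite-clash : ⊥
    bipartite-clash with apex (φ 0F) in p
    ... | false = not-three-of-two (φ≢ λ ()) (φ≢ λ ()) (φ≢ λ ())
      (apex-nbr (hom 0F 1F refl)) (apex-nbr (hom 0F 2F refl)) (apex-nbr (hom 0F 3F refl))
      where
      apex-nbr : ∀ {w} → adj K₂,ₘ (φ 0F) w ≡ true → Apex w
      apex-nbr e = apex-sound (trans (opposite e) (cong not p))
    ... | true = not-three-of-two (φ≢ λ ()) (φ≢ λ ()) (φ≢ λ ())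
      (apex-sound p) (apex-nbr (hom 1F 4F refl)) (apex-nbr (hom 1F 5F refl))
      where
      apex-nbr : ∀ {w} → adj K₂,ₘ (φ 1F) w ≡ true → Apex w
      apex-nbr e = apex-sound (trans (opposite e) (cong not (trans (opposite (hom 0F 1F refl)) (cong not p))))

  edgeCount-K₂,ₘ : edgeCount K₂,ₘ ≡ m + (m + 0)
  edgeCount-K₂,ₘ = trans (edgeCount-extend isSuc (cone (empty m)))
    (cong₂ _+_ (#-everything m) (trans (edgeCount-cone (empty m)) (cong (m +_) (edgeCount-empty m))))

K₂,ₘ-connected : ∀ m → Connected (K₂,ₘ (suc m))
K₂,ₘ-connected m = connected-via zero λ
  { zero          → here
  ; (suc zero)    → step {v = suc (suc zero)} refl (step refl here)
  ; (suc (suc u)) → step refl here }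

-- The cone over a matching

matching : ∀ n → Graph n
matching 0             = empty 0
matching 1             = empty 1
matching (suc (suc n)) = extend isZero (extend nothing (matching n))

edgeCount-matching : ∀ n → edgeCount (matching n) + edgeCount (matching n) ≤ n ×
                           n ≤ suc (edgeCount (matching n) + edgeCount (matching n))
edgeCount-matching 0 = z≤n , z≤n
edgeCount-matching 1 = z≤n , s≤s z≤n
edgeCount-matching (suc (suc n)) with lo , hi ← edgeCount-matching n =
  ≤-trans (≤-reflexive two) (s≤s (s≤s lo)) , ≤-trans (s≤s (s≤s hi)) (≤-reflexive (cong suc (sym two)))
  where
  e = edgeCount (matching n)
  one : edgeCount (matching (suc (suc n))) ≡ suc e
  one = trans (edgeCount-extend isZero (extend nothing (matching n)))
    (cong₂ _+_ (cong suc (#-nothing n)) (trans (edgeCount-extend nothing (matching n)) (cong (_+ e) (#-nothing n))))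
  two : edgeCount (matching (suc (suc n))) + edgeCount (matching (suc (suc n))) ≡ 2 + (e + e)
  two = trans (cong₂ _+_ one one) (cong suc (+-suc e e))

matching-unique : ∀ n {i j k} → adj (matching n) i j ≡ true → adj (matching n) i k ≡ true → j ≡ k
matching-unique (suc (suc n)) {zero}        {suc zero}    {suc zero}    _ _ = refl
matching-unique (suc (suc n)) {suc zero}    {zero}        {zero}        _ _ = refl
matching-unique (suc (suc n)) {suc zero}    {zero}        {suc zero}    _ ()
matching-unique (suc (suc n)) {suc zero}    {zero}        {suc (suc _)} _ ()
matching-unique (suc (suc n)) {suc zero}    {suc zero}    ()
matching-unique (suc (suc n)) {suc zero}    {suc (suc _)} ()
matching-unique (suc (suc n)) {suc (suc i)} {suc (suc j)} {suc (suc k)} p q = cong (λ x → suc (suc x)) (matching-unique n p q)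

-- Apart from the apex, each vertex has at most one neighbour. If the centre is the apex, the second
-- vertex of the long leg has two such neighbours; if not, the centre itself has two among its
-- three.
windmill-S₃₁₁-free : ∀ m → ¬ Contains (cone (matching m)) (Spider (3 ∷ 1 ∷ 1 ∷ []))
windmill-S₃₁₁-free m (φ , inj , hom) = clash
  where
  partner : ∀ {u w w′} → u ≢ zero → w ≢ zero → w′ ≢ zero →
    adj (cone (matching m)) u w ≡ true → adj (cone (matching m)) u w′ ≡ true → w ≡ w′
  partner {zero}                  u≢0 _   _    _ _ = contradiction refl u≢0
  partner {suc u} {zero}          _   w≢0 _    _ _ = contradiction refl w≢0
  partner {suc u} {suc w} {zero}  _   _   w′≢0 _ _ = contradiction refl w′≢0
  partner {suc u} {suc w} {suc x} _   _   _    p q = cong suc (matching-unique m p q)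
  φ≢0 : ∀ {i j} → φ i ≡ zero → i ≢ j → φ j ≢ zero
  φ≢0 φi≡0 i≢j φj≡0 = i≢j (inj (trans φi≡0 (sym φj≡0)))
  distinct : ∀ {i j} → i ≢ j → φ i ≢ φ j
  distinct i≢j = i≢j ∘ inj
  clash : ⊥
  clash with φ 0F ≟ zero
  ... | yes p = distinct {1F} {3F} (λ ())
    (partner (φ≢0 p λ ()) (φ≢0 p λ ()) (φ≢0 p λ ()) (hom 2F 1F refl) (hom 2F 3F refl))
  ... | no φ0≢0 with φ 1F ≟ zero
  ...   | yes p = distinct {4F} {5F} (λ ()) (partner φ0≢0 (φ≢0 p λ ()) (φ≢0 p λ ()) (hom 0F 4F refl) (hom 0F 5F refl))
  ...   | no φ1≢0 with φ 4F ≟ zero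
  ...     | yes p = distinct {1F} {5F} (λ ()) (partner φ0≢0 φ1≢0 (φ≢0 p λ ()) (hom 0F 1F refl) (hom 0F 5F refl))
  ...     | no φ4≢0 = distinct {1F} {4F} (λ ()) (partner φ0≢0 φ1≢0 φ4≢0 (hom 0F 1F refl) (hom 0F 4F refl))

edgeCount-windmill : ∀ m → edgeCount (cone (matching m)) ≡ (3 * m) / 2
edgeCount-windmill m with lo , hi ← edgeCount-matching m =
  trans (edgeCount-cone (matching m)) (half-unique (m + e)
    (≤-trans (≤-reflexive (arith₁ m e)) (≤-trans (+-monoʳ-≤ (m + m) lo) (≤-reflexive (arith₂ m))))
    (≤-trans (≤-reflexive (sym (arith₂ m))) (≤-trans (+-monoʳ-≤ (m + m) hi) (≤-reflexive (arith₃ m e)))))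
  where
  e = edgeCount (matching m)
  arith₁ : ∀ m e → m + e + (m + e) ≡ m + m + (e + e)
  arith₁ = solve-∀
  arith₂ : ∀ m → m + m + m ≡ 3 * m
  arith₂ = solve-∀
  arith₃ : ∀ m e → m + m + suc (e + e) ≡ suc (m + e + (m + e))
  arith₃ = solve-∀

-- The exceptional graph on six vertices

K₃,₃ : Graph 6
K₃,₃ .adj i j = (toℕ i <ᵇ 3) xor (toℕ j <ᵇ 3)
K₃,₃ .adj-sym i j = xor-comm (toℕ i <ᵇ 3) (toℕ j <ᵇ 3)
K₃,₃ .adj-irrefl i = xor-same (toℕ i <ᵇ 3)

K₃,₃-connected : Connected K₃,₃
K₃,₃-connected = connected-via zero λ u → to-zero u (toℕ u <ᵇ 3) refl
  where
  to-zero : ∀ u b → (toℕ u <ᵇ 3) ≡ b → Reach K₃,₃ u zero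
  to-zero u false p = step (trans (cong (_xor true) p) refl) here
  to-zero u true  p = step {v = suc (suc (suc zero))} (trans (cong (_xor false) p) refl) (step refl here)

-- The end of the long leg is at odd distance from the centre, so it lies in the class of the
-- centre's three neighbours: four vertices in a class of three.
K₃,₃-S₃₁₁-free : ¬ Contains K₃,₃ (Spider (3 ∷ 1 ∷ 1 ∷ []))
K₃,₃-S₃₁₁-free (φ , inj , hom) = <⇒≱
  (list⊆-# (adj K₃,₃ (φ zero)) (map φ (1F ∷ 3F ∷ 4F ∷ 5F ∷ []))
    (Unique.map⁺ inj (((λ ()) ∷ (λ ()) ∷ (λ ()) ∷ []) ∷ ((λ ()) ∷ (λ ()) ∷ []) ∷ ((λ ()) ∷ []) ∷ [] ∷ []))
    (hom 0F 1F refl ∷ zigzag {side 0F} {side 1F} {side 2F} {side 3F} (hom 0F 1F refl) (hom 1F 2F refl) (hom 2F 3F refl)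
      ∷ hom 0F 4F refl ∷ hom 0F 5F refl ∷ []))
  (cubic (φ zero))
  where
  side : Fin 6 → Bool
  side i = toℕ (φ i) <ᵇ 3
  zigzag : ∀ {a b c d} → a xor b ≡ true → b xor c ≡ true → c xor d ≡ true → a xor d ≡ true
  zigzag {true}  {false} {true}  {false} _ _ _ = refl
  zigzag {false} {true}  {false} {true}  _ _ _ = refl
  cubic : ∀ u → # (adj K₃,₃ u) ≤ 3
  cubic 0F = ≤-refl
  cubic 1F = ≤-refl
  cubic 2F = ≤-refl
  cubic 3F = ≤-refl
  cubic 4F = ≤-refl
  cubic 5F = ≤-refl

-- Bounded degree and the circulant graph

spiderEdges-ones : ∀ v {i k} → i < k → (0 , v + i) ∈ spiderEdges v (replicate k 1)
spiderEdges-ones v {zero}  {suc k} _         = here (cong (0 ,_) (+-identityʳ v))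
spiderEdges-ones v {suc i} {suc k} (s≤s i<k) =
  there (subst (λ x → (0 , x) ∈ spiderEdges (v + 1) (replicate k 1)) (+-assoc v 1 i) (spiderEdges-ones (v + 1) i<k))

deg≤⇒S₂₁…₁-free : ∀ k (G : Graph n) → (∀ u → deg G u ≤ k) → ¬ Contains G (Spider (2 ∷ replicate k 1))
deg≤⇒S₂₁…₁-free k G deg≤k (φ , inj , hom) = <⇒≱
  (≤-trans (≤-reflexive (cong suc (sym (trans (length-tabulate leaf) (sum-ones k)))))
    (list⊆-# (adj G (φ zero)) (φ (suc zero) ∷ tabulate leaf)
      (All.tabulate⁺ (λ i eq → case inj eq of λ ()) ∷ Unique.tabulate⁺ (Fin.suc-injective ∘ Fin.suc-injective ∘ Fin.suc-injective ∘ inj))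
      (hom zero (suc zero) refl ∷ All.tabulate⁺ (λ i → hom zero (suc (suc (suc i)))
        (edge⇒padj {es = spiderEdges 1 (2 ∷ replicate k 1)} zero (suc (suc (suc i)))
          (there (there (spiderEdges-ones 3 (<-≤-trans (toℕ<n i) (≤-reflexive (sum-ones k)))))))))))
  (deg≤k (φ zero))
  where
  leaf : Fin (sum (replicate k 1)) → Fin _
  leaf i = φ (suc (suc (suc i)))

∑-last : ∀ (f : ℕ → ℕ) p → ∑ {suc p} (f ∘ toℕ) ≡ ∑ {p} (f ∘ toℕ) + f p
∑-last f zero    = +-identityʳ (f 0)
∑-last f (suc p) = trans (cong (f 0 +_) (∑-last (f ∘ suc) p)) (sym (+-assoc (f 0) _ _))

∑-distances : ∀ (g : ℕ → ℕ) i p → ∑ {i + suc p} (λ j → g ∣ i - toℕ j ∣) ≡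
              ∑ {i} (λ s → g (suc (toℕ s))) + (g 0 + ∑ {p} (λ s → g (suc (toℕ s))))
∑-distances g zero    p = refl
∑-distances g (suc i) p = begin
  g (suc i) + ∑ {i + suc p} (λ j → g ∣ i - toℕ j ∣)  ≡⟨ cong (g (suc i) +_) (∑-distances g i p) ⟩
  g (suc i) + (A + B)                                 ≡⟨ regroup (g (suc i)) A B ⟩
  A + g (suc i) + B                                   ≡⟨ cong (_+ B) (sym (∑-last (g ∘ suc) i)) ⟩
  ∑ {suc i} (λ s → g (suc (toℕ s))) + B               ∎
  where
  open ≡-Reasoning
  A B : ℕ
  A = ∑ {i} (λ s → g (suc (toℕ s)))
  B = g 0 + ∑ {p} (λ s → g (suc (toℕ s)))
  regroup : ∀ x a b → x + (a + b) ≡ a + x + b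
  regroup = solve-∀

-- With `i` points on the left and `p` on the right, a shortage `h` - `i` on the left is made up
-- exactly by the `p` - `q` points on the right that are near cyclically.
⊓+∸≡ : ∀ {i p q h} → i + p ≡ q + h → (i ⊓ h) + (p ∸ q) ≡ h
⊓+∸≡ {i} {p} {q} {h} eq with i ≤? h
... | yes i≤h = begin
  (i ⊓ h) + (p ∸ q)   ≡⟨ cong (_+ (p ∸ q)) (m≤n⇒m⊓n≡m i≤h) ⟩
  i + (p ∸ q)         ≡⟨ sym (+-∸-assoc i q≤p) ⟩
  i + p ∸ q           ≡⟨ cong (_∸ q) eq ⟩
  q + h ∸ q           ≡⟨ m+n∸m≡n q h ⟩
  h                   ∎
  where
  open ≡-Reasoning
  q≤p : q ≤ p
  q≤p = +-cancelˡ-≤ i q p (≤-trans (≤-reflexive (+-comm i q)) (≤-trans (+-monoʳ-≤ q i≤h) (≤-reflexive (sym eq))))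
... | no i≰h = begin
  (i ⊓ h) + (p ∸ q)   ≡⟨ cong₂ _+_ (m≥n⇒m⊓n≡n h≤i) (m≤n⇒m∸n≡0 p≤q) ⟩
  h + 0               ≡⟨ +-identityʳ h ⟩
  h                   ∎
  where
  open ≡-Reasoning
  h≤i : h ≤ i
  h≤i = <⇒≤ (≰⇒> i≰h)
  p≤q : p ≤ q
  p≤q = +-cancelʳ-≤ h p q (≤-trans (+-monoʳ-≤ p h≤i) (≤-reflexive (trans (+-comm p i) eq)))

≢true⇒≡false : ∀ {b} → (b ≡ true → ⊥) → b ≡ false
≢true⇒≡false {true}  ¬b = contradiction refl ¬b
≢true⇒≡false {false} _  = refl

≤ᵇ-false : ∀ {a b} → ¬ a ≤ b → (a ≤ᵇ b) ≡ false
≤ᵇ-false ¬le = ≢true⇒≡false (¬le ∘ ≤ᵇ-sound)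

-- Cyclic distances 1, …, h on h + 1 + q points, read off the linear distance.
module Band (h q : ℕ) (h≤q : h ≤ q) where

  band : ℕ → Bool
  band d = (1 ≤ᵇ d) ∧ ((d ≤ᵇ h) ∨ (suc q ≤ᵇ d))

  -- Of the distances 1, ..., `s`, those up to `h` count directly and those beyond `q` by wrapping
  -- around; `h≤q` keeps the two ranges disjoint.
  band-count : ∀ s → ∑ {s} (λ t → ⟦ band (suc (toℕ t)) ⟧) ≡ (s ⊓ h) + (s ∸ q)
  band-count zero    = sym (0∸n≡0 q)
  band-count (suc s) = trans (∑-last (λ t → ⟦ band (suc t) ⟧) s)
    (trans (cong (_+ ⟦ band (suc s) ⟧) (band-count s)) (next s))
    where
    next : ∀ s → (s ⊓ h) + (s ∸ q) + ⟦ band (suc s) ⟧ ≡ (suc s ⊓ h) + (suc s ∸ q)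
    next s with suc s ≤? h
    ... | yes s<h rewrite ≤ᵇ-complete s<h | m≤n⇒m⊓n≡m (<⇒≤ s<h) | m≤n⇒m⊓n≡m s<h
                        | m≤n⇒m∸n≡0 (≤-trans s<h h≤q) | m≤n⇒m∸n≡0 (≤-trans (<⇒≤ s<h) h≤q) =
      trans (cong (_+ 1) (+-identityʳ s)) (trans (+-comm s 1) (sym (+-identityʳ (suc s))))
    ... | no s≮h with suc q ≤? suc s
    ...   | yes q<s+1 rewrite ≤ᵇ-false s≮h | ≤ᵇ-complete q<s+1 | m≥n⇒m⊓n≡n (≮⇒≥ s≮h)
                            | m≥n⇒m⊓n≡n (m≤n⇒m≤1+n (≮⇒≥ s≮h)) | +-∸-assoc 1 (s≤s⁻¹ q<s+1) =
      trans (+-assoc h (s ∸ q) 1) (cong (h +_) (+-comm (s ∸ q) 1))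
    ...   | no q≮s+1 rewrite ≤ᵇ-false s≮h | ≤ᵇ-false q≮s+1 | m≥n⇒m⊓n≡n (≮⇒≥ s≮h)
                            | m≥n⇒m⊓n≡n (m≤n⇒m≤1+n (≮⇒≥ s≮h)) | m≤n⇒m∸n≡0 (s≤s⁻¹ (≰⇒> q≮s+1))
                            | m≤n⇒m∸n≡0 (<⇒≤ (s≤s⁻¹ (≰⇒> q≮s+1))) = +-identityʳ _

  band-degree : ∀ i → i < q + suc h → ∑ {q + suc h} (λ j → ⟦ band ∣ i - toℕ j ∣ ⟧) ≡ h + h
  band-degree i i<n = subst (λ k → ∑ {k} (λ j → ⟦ band ∣ i - toℕ j ∣ ⟧) ≡ h + h) i+1+p≡n (begin
    ∑ {i + suc p} (λ j → ⟦ band ∣ i - toℕ j ∣ ⟧)             ≡⟨ ∑-distances (⟦_⟧ ∘ band) i p ⟩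
    ∑ {i} (λ s → ⟦ band (suc (toℕ s)) ⟧) + ∑ {p} (λ s → ⟦ band (suc (toℕ s)) ⟧)
                                                            ≡⟨ cong₂ _+_ (band-count i) (band-count p) ⟩
    (i ⊓ h) + (i ∸ q) + ((p ⊓ h) + (p ∸ q))                  ≡⟨ regroup (i ⊓ h) (i ∸ q) (p ⊓ h) (p ∸ q) ⟩
    (i ⊓ h) + (p ∸ q) + ((p ⊓ h) + (i ∸ q))                  ≡⟨ cong₂ _+_ (⊓+∸≡ {i} {p} {q} i+p≡q+h) (⊓+∸≡ {p} {i} {q} (trans (+-comm p i) i+p≡q+h)) ⟩
    h + h                                                   ∎)
    where
    open ≡-Reasoning
    p : ℕ
    p = q + suc h ∸ suc i
    i+1+p≡n : i + suc p ≡ q + suc h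
    i+1+p≡n = trans (+-suc i p) (m+[n∸m]≡n i<n)
    i+p≡q+h : i + p ≡ q + h
    i+p≡q+h = suc-injective (trans (sym (+-suc i p)) (trans i+1+p≡n (+-suc q h)))
    regroup : ∀ a b c d → a + b + (c + d) ≡ a + d + (c + b)
    regroup = solve-∀

-- Joining the points at cyclic distance at most k / 2 gives an even degree; for odd k the
-- pairs i, i + ⌊n/2⌋ with i < ⌊n/2⌋ are added, which misses only the vertex 2⌊n/2⌋ of odd n.
module Circulant (n k : ℕ) (2≤k : 2 ≤ k) (k+3≤n : k + 3 ≤ n) where

  private
    h r m q : ℕ
    h = k / 2
    r = k % 2
    m = n / 2
    q = n ∸ suc h

    k≡ : k ≡ h + h + r
    k≡ = trans (m≡m%n+[m/n]*n k 2) (arith h r)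
      where
      arith : ∀ h r → r + h * 2 ≡ h + h + r
      arith = solve-∀

    n≤2m+1 : n ≤ suc (m + m)
    n≤2m+1 = ≤-trans (≤-reflexive (m≡m%n+[m/n]*n n 2))
      (≤-trans (+-monoˡ-≤ (m * 2) (s≤s⁻¹ (m%n<n n 2))) (≤-reflexive (arith m)))
      where
      arith : ∀ m → 1 + m * 2 ≡ suc (m + m)
      arith = solve-∀

    2m≤n : m + m ≤ n
    2m≤n = ≤-trans (≤-reflexive (arith m)) (m/n*n≤m n 2)
      where
      arith : ∀ m → m + m ≡ m * 2
      arith = solve-∀

    2h≤k : h + h ≤ k
    2h≤k = ≤-trans (m≤m+n (h + h) r) (≤-reflexive (sym k≡))

    -- So the added pairs, at distance `m`, are not already joined by the band.
    h<m : h < m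
    h<m = *-cancelʳ-≤ (suc h) m 2 (s≤s⁻¹ (begin
      suc (suc h * 2)  ≡⟨ arith₁ h ⟩
      h + h + 3        ≤⟨ +-monoˡ-≤ 3 2h≤k ⟩
      k + 3            ≤⟨ k+3≤n ⟩
      n                ≤⟨ n≤2m+1 ⟩
      suc (m + m)      ≡⟨ cong suc (arith₂ m) ⟩
      suc (m * 2)      ∎))
      where
      open ≤-Reasoning
      arith₁ : ∀ h → suc (suc h * 2) ≡ h + h + 3
      arith₁ = solve-∀
      arith₂ : ∀ m → m + m ≡ m * 2
      arith₂ = solve-∀

    h+1+h≤n : h + suc h ≤ n
    h+1+h≤n = ≤-trans (+-mono-≤ (<⇒≤ h<m) h<m) 2m≤n

    q+1+h≡n : q + suc h ≡ n
    q+1+h≡n = m∸n+n≡m (≤-trans (m≤n+m (suc h) h) h+1+h≤n)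

    open Band h q (m+n≤o⇒m≤o∸n h h+1+h≤n)

    matched : ℕ → ℕ → Bool
    matched i j = (r ≡ᵇ 1) ∧ ((∣ i - j ∣ ≡ᵇ m) ∧ (not (i ≡ᵇ m + m) ∧ not (j ≡ᵇ m + m)))

    not-sound : ∀ {a b} → not (a ≡ᵇ b) ≡ true → a ≢ b
    not-sound {a} p refl rewrite ≡ᵇ-refl a = case p of λ ()

    not-complete : ∀ {a b} → a ≢ b → not (a ≡ᵇ b) ≡ true
    not-complete a≢b = cong not (≢true⇒≡false (a≢b ∘ ≡ᵇ-sound))

    ≡ᵇ-complete : ∀ {a b} → a ≡ b → (a ≡ᵇ b) ≡ true
    ≡ᵇ-complete {a} refl = ≡ᵇ-refl a

    matched-sound : ∀ {i j} → matched i j ≡ true → r ≡ 1 × ∣ i - j ∣ ≡ m × i ≢ m + m × j ≢ m + m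
    matched-sound {i} {j} p
      with r≡1 , p₁ ← ∧-true {r ≡ᵇ 1} p
      with d≡m , p₂ ← ∧-true {∣ i - j ∣ ≡ᵇ m} p₁
      with i≢ , j≢ ← ∧-true {not (i ≡ᵇ m + m)} p₂ =
      ≡ᵇ-sound r≡1 , ≡ᵇ-sound d≡m , not-sound i≢ , not-sound j≢

    matched-complete : ∀ {i j} → r ≡ 1 → ∣ i - j ∣ ≡ m → i ≢ m + m → j ≢ m + m → matched i j ≡ true
    matched-complete r≡1 d≡m i≢ j≢ =
      ∧-intro (≡ᵇ-complete r≡1) (∧-intro (≡ᵇ-complete d≡m) (∧-intro (not-complete i≢) (not-complete j≢)))

    matched-sym : ∀ i j → matched i j ≡ matched j i
    matched-sym i j = cong ((r ≡ᵇ 1) ∧_) (cong₂ _∧_ (cong (_≡ᵇ m) (∣-∣-comm i j)) (∧-comm (not (i ≡ᵇ m + m)) _))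

    distance : ∀ i j → ∣ i - j ∣ ≡ m → j ≡ i + m ⊎ i ≡ j + m
    distance i j d≡m with ≤-total i j
    ... | inj₁ i≤j = inj₁ (trans (sym (m+[n∸m]≡n i≤j)) (cong (i +_) (trans (sym (m≤n⇒∣m-n∣≡n∸m i≤j)) d≡m)))
    ... | inj₂ j≤i = inj₂ (trans (sym (m+[n∸m]≡n j≤i)) (cong (j +_) (trans (sym (m≤n⇒∣n-m∣≡n∸m j≤i)) d≡m)))

    below : ∀ {j} → j < n → j ≢ m + m → j < m + m
    below j<n j≢ = ≤∧≢⇒< (s≤s⁻¹ (≤-trans j<n n≤2m+1)) j≢

    -- Partners on opposite sides of `i` would be `m + m` apart, but both lie below `m + m` once
    -- that vertex is excluded.
    matched-unique : ∀ {i j j′} → j < n → j′ < n → matched i j ≡ true → matched i j′ ≡ true → j ≡ j′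
    matched-unique {i} {j} {j′} j<n j′<n p p′
      with _ , d , _ , j≢ ← matched-sound {i} {j} p | _ , d′ , _ , j′≢ ← matched-sound {i} {j′} p′
      with distance i j d | distance i j′ d′
    ... | inj₁ refl | inj₁ refl = refl
    ... | inj₂ eq   | inj₂ eq′  = +-cancelʳ-≡ m j j′ (trans (sym eq) eq′)
    ... | inj₁ refl | inj₂ refl = contradiction (below j<n j≢) (≤⇒≯ (+-monoˡ-≤ m (m≤n+m m j′)))
    ... | inj₂ refl | inj₁ refl = contradiction (below j′<n j′≢) (≤⇒≯ (+-monoˡ-≤ m (m≤n+m m j)))

    matched-exists : r ≡ 1 → ∀ {i} → i < n → i ≢ m + m → ∃ λ j → j < n × matched i j ≡ true
    matched-exists r≡1 {i} i<n i≢ with m ≤? i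
    ... | no m≰i = i + m , <-≤-trans (+-monoˡ-< m (≰⇒> m≰i)) 2m≤n ,
      matched-complete {i} r≡1 (∣m-m+n∣≡n i m) i≢ (λ eq → m≰i (≤-reflexive (sym (+-cancelʳ-≡ m i m eq))))
    ... | yes m≤i = i ∸ m , ≤-<-trans (m∸n≤m i m) i<n ,
      matched-complete {i} r≡1 (trans (m≤n⇒∣n-m∣≡n∸m (m∸n≤m i m)) (m∸[m∸n]≡n m≤i)) i≢
        (λ eq → <⇒≱ (below i<n i≢) (≤-trans (≤-reflexive (sym eq)) (m∸n≤m i m)))

    disjoint : ∀ {i j} → matched i j ≡ true → band ∣ i - j ∣ ≡ true → ⊥
    disjoint {i} {j} p b with _ , d≡m , _ ← matched-sound {i} {j} p
      with ∨-true (proj₂ (∧-true {1 ≤ᵇ ∣ i - j ∣} b))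
    ... | inj₁ d≤h = <⇒≱ h<m (≤-trans (≤-reflexive (sym d≡m)) (≤ᵇ-sound {∣ i - j ∣} d≤h))
    ... | inj₂ q<d = <⇒≱ (+-monoʳ-< m h<m) (begin
      m + m            ≤⟨ 2m≤n ⟩
      n                ≡⟨ sym q+1+h≡n ⟩
      q + suc h        ≡⟨ +-suc q h ⟩
      suc q + h        ≤⟨ +-monoˡ-≤ h (≤ᵇ-sound q<d) ⟩
      ∣ i - j ∣ + h    ≡⟨ cong (_+ h) d≡m ⟩
      m + h            ∎)
      where open ≤-Reasoning

  circulant : Graph n
  circulant .adj i j = band ∣ toℕ i - toℕ j ∣ ∨ matched (toℕ i) (toℕ j)
  circulant .adj-sym i j = cong₂ _∨_ (cong band (∣-∣-comm (toℕ i) (toℕ j))) (matched-sym (toℕ i) (toℕ j))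
  circulant .adj-irrefl i = cong₂ _∨_ (cong band (∣n-n∣≡0 (toℕ i)))
    (≢true⇒≡false λ p → case trans (sym (∣n-n∣≡0 (toℕ i))) (proj₁ (proj₂ (matched-sound {toℕ i} p))) of λ
      0≡m → <⇒≱ h<m (≤-trans (≤-reflexive (sym 0≡m)) z≤n))

  circulant-connected : Connected circulant
  circulant-connected = consecutive⇒connected circulant λ {i} {j} j≡1+i → ∨-introˡ
    (trans (cong band (trans (cong (∣_- toℕ i ∣) j≡1+i) (1+n-n (toℕ i)))) (∨-introˡ (≤ᵇ-complete 1≤h)))
    where
    1+n-n : ∀ a → ∣ suc a - a ∣ ≡ 1
    1+n-n zero    = refl
    1+n-n (suc a) = 1+n-n a
    1≤h : 1 ≤ h
    1≤h = /-monoˡ-≤ 2 2≤k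

  private
    #band : Fin n → ℕ
    #band i = # (λ (j : Fin n) → band ∣ toℕ i - toℕ j ∣)

    #band≡ : ∀ i → #band i ≡ h + h
    #band≡ i = subst (λ k → ∑ {k} (λ j → ⟦ band ∣ toℕ i - toℕ j ∣ ⟧) ≡ h + h) q+1+h≡n
      (band-degree (toℕ i) (<-≤-trans (toℕ<n i) (≤-reflexive (sym q+1+h≡n))))

    #matched : Fin n → ℕ
    #matched i = # (λ (j : Fin n) → matched (toℕ i) (toℕ j))

    #matched≤r : ∀ i → #matched i ≤ r
    #matched≤r i with any? (λ (j : Fin n) → matched (toℕ i) (toℕ j) Bool.≟ true)
    ... | no ∄ = ≤-trans (#-⊆list {n} (λ j → matched (toℕ i) (toℕ j)) [] (λ j p → contradiction (j , p) ∄)) z≤n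
    ... | yes (j , p) = ≤-trans
      (#-⊆list {n} (λ j → matched (toℕ i) (toℕ j)) (j ∷ []) (λ j′ p′ → here (toℕ-injective (matched-unique {toℕ i} (toℕ<n j′) (toℕ<n j) p′ p))))
      (≤-reflexive (sym (proj₁ (matched-sound {toℕ i} p))))

    r≤#matched : ∀ i → r ≤ #matched i + ⟦ toℕ i ≡ᵇ m + m ⟧
    r≤#matched i with r ≤? 0 | toℕ i ℕ.≟ m + m
    ... | yes r≤0 | _ = ≤-trans r≤0 z≤n
    ... | no _ | yes i≡ = ≤-trans (s≤s⁻¹ (m%n<n k 2)) (≤-trans (≤-reflexive (sym (cong ⟦_⟧ (≡ᵇ-complete i≡)))) (m≤n+m _ _))
    ... | no r≰0 | no i≢ with j , j<n , p ← matched-exists (≤-antisym (s≤s⁻¹ (m%n<n k 2)) (≰⇒> r≰0)) (toℕ<n i) i≢ =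
      ≤-trans (s≤s⁻¹ (m%n<n k 2)) (≤-trans
        (list⊆-# {n} (λ j → matched (toℕ i) (toℕ j)) (fromℕ< j<n ∷ []) ([] ∷ []) (trans (cong (matched (toℕ i)) (toℕ-fromℕ< j<n)) p ∷ []))
        (m≤m+n _ _))

    #band+#matched : ∀ i → ∑ {n} (λ j → ⟦ band ∣ toℕ i - toℕ j ∣ ⟧ + ⟦ matched (toℕ i) (toℕ j) ⟧) ≡ #band i + #matched i
    #band+#matched i = ∑-distrib-+ {n} (λ j → ⟦ band ∣ toℕ i - toℕ j ∣ ⟧) (λ j → ⟦ matched (toℕ i) (toℕ j) ⟧)

  deg≤k : ∀ i → deg circulant i ≤ k
  deg≤k i = begin
    deg circulant i         ≤⟨ ∑-mono {n} (λ j → ⟦∨⟧≤ (band ∣ toℕ i - toℕ j ∣) (matched (toℕ i) (toℕ j))) ⟩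
    ∑ {n} (λ j → ⟦ band ∣ toℕ i - toℕ j ∣ ⟧ + ⟦ matched (toℕ i) (toℕ j) ⟧)  ≡⟨ #band+#matched i ⟩
    #band i + #matched i    ≤⟨ +-mono-≤ (≤-reflexive (#band≡ i)) (#matched≤r i) ⟩
    h + h + r               ≡⟨ sym k≡ ⟩
    k                       ∎
    where open ≤-Reasoning

  -- The indicator pays for the vertex left unmatched when n and `k` are both odd; it is the unit
  -- that the floor of half of `n * k` loses.
  k≤deg+ : ∀ i → k ≤ deg circulant i + ⟦ toℕ i ≡ᵇ m + m ⟧
  k≤deg+ i = begin
    k                             ≡⟨ k≡ ⟩
    h + h + r                     ≤⟨ +-mono-≤ (≤-reflexive (sym (#band≡ i))) (r≤#matched i) ⟩
    #band i + (#matched i + last) ≡⟨ sym (+-assoc (#band i) (#matched i) last) ⟩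
    #band i + #matched i + last   ≤⟨ +-monoˡ-≤ last (≤-trans (≤-reflexive (sym (#band+#matched i)))
                                       (∑-mono {n} (λ j → +-≤-∨ (disjoint {toℕ i} {toℕ j})))) ⟩
    deg circulant i + last        ∎
    where
    open ≤-Reasoning
    last : ℕ
    last = ⟦ toℕ i ≡ᵇ m + m ⟧
    +-≤-∨ : ∀ {a b} → (b ≡ true → a ≡ true → ⊥) → ⟦ a ⟧ + ⟦ b ⟧ ≤ ⟦ a ∨ b ⟧
    +-≤-∨ {true}  {true}  dis = contradiction refl (dis refl)
    +-≤-∨ {true}  {false} _   = ≤-refl
    +-≤-∨ {false} {b}     _   = ≤-refl

  edgeCount-circulant : edgeCount circulant ≡ (n * k) / 2
  edgeCount-circulant = half-unique (edgeCount circulant)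
    (begin
      E + E               ≡⟨ handshake circulant ⟩
      ∑ (deg circulant)   ≤⟨ ∑-mono {n} deg≤k ⟩
      ∑ {n} (λ _ → k)     ≡⟨ ∑-const n k ⟩
      n * k               ∎)
    (begin
      n * k               ≡⟨ sym (∑-const n k) ⟩
      ∑ {n} (λ _ → k)     ≤⟨ ∑-mono {n} k≤deg+ ⟩
      ∑ {n} (λ i → deg circulant i + ⟦ toℕ i ≡ᵇ m + m ⟧)  ≡⟨ ∑-distrib-+ {n} (deg circulant) (λ i → ⟦ toℕ i ≡ᵇ m + m ⟧) ⟩
      ∑ (deg circulant) + # (λ (i : Fin n) → toℕ i ≡ᵇ m + m)  ≤⟨ +-monoʳ-≤ (∑ (deg circulant)) one ⟩
      ∑ (deg circulant) + 1   ≡⟨ +-comm _ 1 ⟩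
      suc (∑ (deg circulant)) ≡⟨ cong suc (sym (handshake circulant)) ⟩
      suc (E + E)         ∎)
    where
    open ≤-Reasoning
    E : ℕ
    E = edgeCount circulant
    one : # (λ (i : Fin n) → toℕ i ≡ᵇ m + m) ≤ 1
    one with any? (λ (i : Fin n) → toℕ i ℕ.≟ m + m)
    ... | no ∄ = ≤-trans (#-⊆list {n} (λ i → toℕ i ≡ᵇ m + m) [] (λ i p → contradiction (i , ≡ᵇ-sound p) ∄)) z≤n
    ... | yes (i , i≡) = #-⊆list {n} (λ i → toℕ i ≡ᵇ m + m) (i ∷ []) (λ j p → here (toℕ-injective (trans (≡ᵇ-sound p) (sym i≡))))

-- From degree sums to the extremal numbers

double-cancel : ∀ {a b} → a + a ≤ suc (b + b) → a ≤ b
double-cancel {a} {b} le = ≮⇒≥ λ b<a → <⇒≱ (s≤s le) (≤-trans (≤-reflexive (cong suc (sym (+-suc b b)))) (+-mono-≤ b<a b<a))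

-- The parity gain: for `c` = 4 and `c′` = 7 the degree sum is even, so a deficit of 7 is one of 8.
double-shift : ∀ {e} c {c′ n} → c + c ≤ suc c′ → e + e + c′ ≤ n * 4 → e ≤ 2 * n ∸ c
double-shift {e} c {c′} {n} 2c≤ le = m+n≤o⇒m≤o∸n e (double-cancel (begin
  e + c + (e + c)         ≡⟨ arith₁ e c ⟩
  e + e + (c + c)         ≤⟨ +-monoʳ-≤ (e + e) 2c≤ ⟩
  e + e + suc c′          ≡⟨ +-suc (e + e) c′ ⟩
  suc (e + e + c′)        ≤⟨ s≤s le ⟩
  suc (n * 4)             ≡⟨ cong suc (arith₂ n) ⟩
  suc (2 * n + 2 * n)     ∎))
  where
  open ≤-Reasoning
  arith₁ : ∀ e c → e + c + (e + c) ≡ e + e + (c + c)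
  arith₁ = solve-∀
  arith₂ : ∀ n → n * 4 ≡ 2 * n + 2 * n
  arith₂ = solve-∀

exc-S₂₁…₁ : ∀ k n → 2 ≤ k → k + 3 ≤ n → IsExc n (Spider (2 ∷ replicate k 1)) ((n * k) / 2)
exc-S₂₁…₁ k n 2≤k k+3≤n =
  (circulant , circulant-connected , deg≤⇒S₂₁…₁-free k circulant deg≤k , edgeCount-circulant) ,
  λ G conn free → e+e≤m⇒e≤m/2 (edgeCount G)
    (≤-trans (≤-reflexive (handshake G)) (S₂₁…₁-free⇒∑deg≤ G conn 2≤k k+3≤n free))
  where open Circulant n k 2≤k k+3≤n

exc-D₂₂ : ∀ n → 6 ≤ n → IsExc n (DoubleStar 2 2) (2 * n ∸ 4)
exc-D₂₂ (suc zero)       (s≤s ())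
exc-D₂₂ (suc (suc zero)) (s≤s (s≤s ()))
-- Three successors, because K_{2,m} needs a middle vertex to be connected.
exc-D₂₂ n@(suc (suc (suc m))) 6≤n =
  (K₂,ₘ (suc m) , K₂,ₘ-connected m , K₂,ₘ-D₂₂-free (suc m) ,
    trans (edgeCount-K₂,ₘ (suc m)) (sym (cong (_∸ 4) (arith m)))) ,
  λ G conn free → double-shift 4 {n = n} ≤-refl
    (≤-trans (≤-reflexive (cong (_+ 7) (handshake G))) (D₂₂-free⇒∑deg≤ G conn 6≤n free))
  where
  arith : ∀ m → 2 * (3 + m) ≡ 4 + (suc m + (suc m + 0))
  arith = solve-∀

exc-S₂₂₁ : ∀ n → 6 ≤ n → IsExc n (Spider (2 ∷ 2 ∷ 1 ∷ [])) (2 * n ∸ 3)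
exc-S₂₂₁ (suc zero) (s≤s ())
exc-S₂₂₁ n@(suc (suc m)) 6≤n =
  (K₁,₁,ₘ m , cone-connected _ , K₁,₁,ₘ-S₂₂₁-free m ,
    trans (edgeCount-K₁,₁,ₘ m) (sym (cong (_∸ 3) (arith m)))) ,
  λ G conn free → double-shift 3 {n = n} (n≤1+n 6)
    (≤-trans (≤-reflexive (cong (_+ 6) (handshake G))) (S₂₂₁-free⇒∑deg≤ G conn 6≤n free))
  where
  arith : ∀ m → 2 * (2 + m) ≡ 3 + (suc m + (m + 0))
  arith = solve-∀

exc-S₃₁₁ : ∀ n → 7 ≤ n → IsExc n (Spider (3 ∷ 1 ∷ 1 ∷ [])) ((3 * (n ∸ 1)) / 2)
exc-S₃₁₁ n@(suc m) 7≤n =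
  (cone (matching m) , cone-connected _ , windmill-S₃₁₁-free m , edgeCount-windmill m) ,
  λ G conn free → e+e≤m⇒e≤m/2 (edgeCount G) (+-cancelʳ-≤ 3 _ _ (begin
    edgeCount G + edgeCount G + 3   ≡⟨ cong (_+ 3) (handshake G) ⟩
    ∑ (deg G) + 3                   ≤⟨ combine (S₃₁₁-free⇒∑deg≤ G conn free (<⇒≤ 7≤n)) ⟩
    n * 3                           ≡⟨ arith₁ m ⟩
    3 * m + 3                       ∎))
  where
  open ≤-Reasoning
  arith₁ : ∀ m → suc m * 3 ≡ 3 * m + 3
  arith₁ = solve-∀
  arith₂ : ∀ n → n * 2 + n ≡ n * 3
  arith₂ = solve-∀
  combine : ∀ {s} → s + 3 ≤ n * 3 ⊎ s ≤ n * 2 + 4 ⊎ s ≤ 18 → s + 3 ≤ n * 3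
  combine (inj₁ le)        = le
  combine (inj₂ (inj₁ le)) = ≤-trans (+-monoˡ-≤ 3 le) (≤-trans (≤-reflexive (+-assoc (n * 2) 4 3))
    (≤-trans (+-monoʳ-≤ (n * 2) 7≤n) (≤-reflexive (arith₂ n))))
  combine (inj₂ (inj₂ le)) = ≤-trans (+-monoˡ-≤ 3 le) (*-monoˡ-≤ 3 7≤n)

exc-S₃₁₁-six : IsExc 6 (Spider (3 ∷ 1 ∷ 1 ∷ [])) 9
exc-S₃₁₁-six =
  (K₃,₃ , K₃,₃-connected , K₃,₃-S₃₁₁-free , refl) ,
  λ G conn free → double-cancel (≤-trans (≤-reflexive (handshake G))
    (combine (S₃₁₁-free⇒∑deg≤ G conn free ≤-refl)))
  where
  combine : ∀ {s} → s + 3 ≤ 18 ⊎ s ≤ 16 ⊎ s ≤ 18 → s ≤ 19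
  combine (inj₁ le)        = ≤-trans (m≤m+n _ 3) (m≤n⇒m≤1+n le)
  combine (inj₂ (inj₁ le)) = ≤-trans le (m≤m+n 16 3)
  combine (inj₂ (inj₂ le)) = m≤n⇒m≤1+n le

theorem1p6 : (∀ (k n : ℕ) → 2 ≤ k → k + 3 ≤ n →
    IsExc n (Spider (2 ∷ replicate k 1)) ((n * k) / 2)) ×
    (∀ (n : ℕ) → 5 ≤ n → IsExc n (Spider (2 ∷ 1 ∷ 1 ∷ [])) n) ×
    (∀ (n : ℕ) → 6 ≤ n → IsExc n (Spider (2 ∷ 1 ∷ 1 ∷ 1 ∷ [])) ((3 * n) / 2)) ×
    (∀ (n : ℕ) → 6 ≤ n → IsExc n (DoubleStar 2 2) (2 * n ∸ 4)) ×
    (∀ (n : ℕ) → 7 ≤ n → IsExc n (Spider (3 ∷ 1 ∷ 1 ∷ [])) ((3 * (n ∸ 1)) / 2)) ×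
    IsExc 6 (Spider (3 ∷ 1 ∷ 1 ∷ [])) 9 ×
    (∀ (n : ℕ) → 6 ≤ n → IsExc n (Spider (2 ∷ 2 ∷ 1 ∷ [])) (2 * n ∸ 3))
theorem1p6 =
  exc-S₂₁…₁ ,
  (λ n 5≤n → subst (IsExc n (Spider (2 ∷ 1 ∷ 1 ∷ []))) (m*n/n≡m n 2) (exc-S₂₁…₁ 2 n ≤-refl 5≤n)) ,
  (λ n 6≤n → subst (IsExc n (Spider (2 ∷ 1 ∷ 1 ∷ 1 ∷ []))) (cong (_/ 2) (*-comm n 3))
    (exc-S₂₁…₁ 3 n (n≤1+n 2) 6≤n)) ,
  exc-D₂₂ ,
  exc-S₃₁₁ ,
  exc-S₃₁₁-six ,
  exc-S₂₂₁
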